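{- Let $A$ be a set of actions. The following two statements hold. (i) $\mathsf{Mil}$ is complete for 1-bisimilarity of chart interpretations of two star expressions via a guarded LLEE-1-chart as joint expansion: for all $e_1,e_2\in StExp(A)$, if there is a guarded LLEE-1-chart $C$ such that there are a functional 1-bisimulation from $C$ to $\mathcal C(e_1)$ and a functional 1-bisimulation from $C$ to $\mathcal C(e_2)$, then $e_1=_{\mathsf{Mil}}e_2$. (ii) $\mathsf{Mil}$ is complete for 1-bisimilarity of chart interpretations of two star expressions via a guarded LLEE-1-chart as joint minimization: for all $e_1,e_2\in StExp(A)$, if there is a guarded LLEE-1-chart $C$ such that there are a functional 1-bisimulation from $\mathcal C(e_1)$ to $C$ and a functional 1-bisimulation from $\mathcal C(e_2)$ to $C$, then $e_1=_{\mathsf{Mil}}e_2$.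
   Context: **Star expressions.** For a set $A$ of actions, the set $StExp(A)$ of star expressions is generated by $e ::= 0\mid 1\mid a\mid (e_1+e_2)\mid (e_1\cdot e_2)\mid e^*$ with $a\in A$. Immediate termination $e{\downarrow}$ is defined inductively by: $1{\downarrow}$; $(e_1+e_2){\downarrow}$ if $e_1{\downarrow}$ or $e_2{\downarrow}$; $(e_1\cdot e_2){\downarrow}$ if $e_1{\downarrow}$ and $e_2{\downarrow}$; $(e^*){\downarrow}$ always. Write $e{\not\downarrow}$ if $e{\downarrow}$ does not hold. **Milner's system.** $\mathsf{Mil}$ is the Hilbert-style proof system whose formulas are the formal equations between star expressions over $A$, with the rules reflexivity, symmetry, transitivity, the context rule (from $e=f$ infer $C[e]=C[f]$ for one-hole star expression contexts $C$), and $\mathrm{RSP}^*$ (from $e=f\cdot e+g$ infer $e=f^*\cdot g$, provided $f{\not\downarrow}$), and with the axiom schemes: $(e+f)+g=e+(f+g)$, $e+0=e$, $e+f=f+e$, $e+e=e$, $(e\cdot f)\cdot g=e\cdot(f\cdot g)$, $(e+f)\cdot g=e\cdot g+f\cdot g$, $1\cdot e=e$, $e\cdot 1=e$, $0\cdot e=0$, $e^*=1+e\cdot e^*$, $e^*=(1+e)^*$. $e=_{\mathsf{Mil}}f$ means that $e=f$ is derivable in $\mathsf{Mil}$ without assumptions. **1-charts.** A 1-chart is $C=\langle V,A,1,v_s,\to,\downarrow\rangle$ with a finite set $V$ of vertices, a set $A$ of (proper) action labels, an empty-step label $1\notin A$, a start vertex $v_s\in V$, a transition relation $\to\,\subseteq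 V\times(A\cup\{1\})\times V$, and a set $\downarrow\,\subseteq V$ of vertices with immediate termination. Transitions with label in $A$ are proper; those with label $1$ are 1-transitions. A chart is a 1-chart without 1-transitions. **Chart interpretation.** The transition relation on $StExp(A)$ is defined inductively by the rules: $a\xrightarrow{a}1$; if $e_i\xrightarrow{a}e_i'$ then $e_1+e_2\xrightarrow{a}e_i'$ ($i=1,2$); if $e_1\xrightarrow{a}e_1'$ then $e_1\cdot e_2\xrightarrow{a}e_1'\cdot e_2$; if $e_1{\downarrow}$ and $e_2\xrightarrow{a}e_2'$ then $e_1\cdot e_2\xrightarrow{a}e_2'$; if $e\xrightarrow{a}e'$ then $e^*\xrightarrow{a}e'\cdot e^*$. The chart interpretation $\mathcal C(e)$ is the chart with start vertex $e$, whose vertices are all star expressions reachable from $e$ via these transitions, with the induced transitions, and with immediate termination at exactly those of its vertices $f$ for which $f{\downarrow}$ holds according to the inductive rules: $1{\downarrow}$; $(e_1+e_2){\downarrow}$ if $e_1{\downarrow}$ or $e_2{\downarrow}$; $(e_1\cdot e_2){\downarrow}$ if $e_1{\downarrow}$ and $e_2{\downarrow}$; $(e_1^*){\downarrow}$ always. **1-bisimulations.** In a 1-chart, an induced $a$-transition $v\xrightarrow{(a]}w$ ($a\in A$) is a path consisting of finitely many (possibly zero) 1-transitions followed by a proper $a$-transition; induced termination $v{\downarrow^{(1)}}$ means that there is a path of finitely many (possibly zero) 1-transitions from $v$ to some $\tilde v$ with $\tilde v{\downarrow}$. A 1-bisimulation between 1-charts $C_1,C_2$ is a relation $B\subseteq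 V_1\times V_2$ that relates the start vertices and such that for all $\langle v_1,v_2\rangle\in B$: (forth) if $v_1\xrightarrow{(a]}v_1'$ then there is $v_2'$ with $v_2\xrightarrow{(a]}v_2'$ and $\langle v_1',v_2'\rangle\in B$; (back) symmetrically; (termination) $v_1{\downarrow^{(1)}}$ iff $v_2{\downarrow^{(1)}}$. A functional 1-bisimulation from $C_1$ to $C_2$ is a 1-bisimulation between $C_1$ and $C_2$ that is the graph of a function $V_1\to V_2$. **Guarded LLEE-1-charts.** A loop 1-chart is a 1-chart such that (L1) there is an infinite path from the start vertex, (L2) every infinite path from the start vertex returns to it after a positive number of transitions, (L3) immediate termination is only permitted at the start vertex. Its transitions from the start vertex are its loop-entry transitions, all other transitions belong to its body. A loop sub-1-chart of $C$ is a loop 1-chart $L$ that is a sub-1-chart of $C$ with some vertex $v$ of $C$ as start vertex, formed, for a nonempty set $U$ of transitions of $C$ from $v$ (the loop-entry transitions of $L$), by all vertices and transitions on paths that start with a transition in $U$ and continue onward until $v$ is reached again. A multi-step loop elimination of loop sub-1-charts $L_1,\dots,L_n$ ($n\ge1$) from $C$, where their sets of loop-entry transitions are pairwise disjoint and no start vertex of one is in the body of another one, removes all loop-entry transitions of $L_1,\dots,L_n$, and then all vertices and transitions that become unreachable. A run (sequence of multi-steps) from $C$ is successful if it leads to a 1-chart without an infinite path; it is layered if it never removes loop-entry transitions that depart from a vertex in the body of a previously eliminated loop sub-1-chart. A LLEE-witness of $C$ is the labeling of the transitions of $C$ by natural numbers that records a successful layered run: marking label $n\ge1$ for transitions removed as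 loop-entry transitions in the $n$-th multi-step ('loop-entry transitions'), label $0$ for all other transitions ('body transitions'). It is guarded if all of its loop-entry transitions are proper. A guarded LLEE-1-chart is a 1-chart that has a guarded LLEE-witness. -}

module Defs where

open import Level using (0ℓ)
open import Data.Empty using (⊥)
open import Data.Fin using (Fin)
open import Data.List using (List; []; _∷_; _++_; map)
open import Data.List.Membership.Propositional using () renaming (_∈_ to _∈ₗ_)
open import Data.List.Membership.Propositional.Properties
  using (∈-++⁺ˡ; ∈-++⁺ʳ; ∈-++⁻; ∈-map⁺; ∈-map⁻)
open import Data.List.Relation.Unary.Any using (here; there)
open import Data.Maybe using (Maybe; just; nothing)
open import Data.Nat using (ℕ; zero; suc)
open import Data.Product using (Σ-syntax; ∃; ∃-syntax; _×_; _,_; proj₁; proj₂)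
open import Data.Sum using (_⊎_; inj₁; inj₂)
open import Data.Unit.Polymorphic using (⊤)
open import Function.Bundles using (_⇔_)
open import Relation.Binary.Construct.Closure.ReflexiveTransitive
  using (Star; ε; _◅_; _◅◅_)
open import Relation.Binary.PropositionalEquality using (_≡_; _≢_; refl)
open import Relation.Nullary using (¬_)
open import Relation.Unary using (Pred; _∈_; _⊆_)

infixl 6 _+_
infixl 7 _·_
infix  8 _*

data StExp (A : Set) : Set where
  𝟘 𝟙 : StExp A
  act : A → StExp A
  _+_ : StExp A → StExp A → StExp A
  _·_ : StExp A → StExp A → StExp A
  _*  : StExp A → StExp A

infix 4 _↓

data _↓ {A : Set} : StExp A → Set where
  𝟙↓  : 𝟙 ↓
  +↓ˡ : ∀ {e f} → e ↓ → (e + f) ↓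
  +↓ʳ : ∀ {e f} → f ↓ → (e + f) ↓
  ·↓  : ∀ {e f} → e ↓ → f ↓ → (e · f) ↓
  *↓  : ∀ {e} → (e *) ↓

infix 4 _—[_]→_

data _—[_]→_ {A : Set} : StExp A → A → StExp A → Set where
  act→ : ∀ {a} → act a —[ a ]→ 𝟙
  +→ˡ  : ∀ {e f a e′} → e —[ a ]→ e′ → e + f —[ a ]→ e′
  +→ʳ  : ∀ {e f a f′} → f —[ a ]→ f′ → e + f —[ a ]→ f′
  ·→ˡ  : ∀ {e f a e′} → e —[ a ]→ e′ → e · f —[ a ]→ e′ · f
  ·→ʳ  : ∀ {e f a f′} → e ↓ → f —[ a ]→ f′ → e · f —[ a ]→ f′
  *→   : ∀ {e a e′} → e —[ a ]→ e′ → e * —[ a ]→ e′ · e *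

data Context (A : Set) : Set where
  □        : Context A
  _+ˡ_ _·ˡ_ : Context A → StExp A → Context A
  _+ʳ_ _·ʳ_ : StExp A → Context A → Context A
  _⋆       : Context A → Context A

_[_] : ∀ {A} → Context A → StExp A → StExp A
□        [ e ] = e
(C +ˡ f) [ e ] = (C [ e ]) + f
(f +ʳ C) [ e ] = f + (C [ e ])
(C ·ˡ f) [ e ] = (C [ e ]) · f
(f ·ʳ C) [ e ] = f · (C [ e ])
(C ⋆)    [ e ] = (C [ e ]) *

infix 4 _=Mil_

data _=Mil_ {A : Set} : StExp A → StExp A → Set where
  reflexivity  : ∀ {e} → e =Mil e
  symmetry     : ∀ {e f} → e =Mil f → f =Mil e
  transitivity : ∀ {e f g} → e =Mil f → f =Mil g → e =Mil g
  context      : ∀ {e f} (C : Context A) → e =Mil f → C [ e ] =Mil C [ f ]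
  RSP*         : ∀ {e f g} → ¬ (f ↓) → e =Mil f · e + g → e =Mil f * · g

  +-assoc     : ∀ {e f g} → (e + f) + g =Mil e + (f + g)
  +-identity  : ∀ {e} → e + 𝟘 =Mil e
  +-comm      : ∀ {e f} → e + f =Mil f + e
  +-idem      : ∀ {e} → e + e =Mil e
  ·-assoc     : ∀ {e f g} → (e · f) · g =Mil e · (f · g)
  ·-distrib-+ : ∀ {e f g} → (e + f) · g =Mil e · g + f · g
  ·-identityˡ : ∀ {e} → 𝟙 · e =Mil e
  ·-identityʳ : ∀ {e} → e · 𝟙 =Mil e
  ·-zeroˡ     : ∀ {e} → 𝟘 · e =Mil 𝟘
  *-unfold    : ∀ {e} → e * =Mil 𝟙 + e · e *
  *-𝟙+        : ∀ {e} → e * =Mil (𝟙 + e) *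

-- The set A ∪ {1} of labels; the empty step 1 is 'nothing', so that it
-- is never a proper action.
Label : Set → Set
Label A = Maybe A

pattern one      = nothing
pattern proper a = just a

-- A subset is finite if some list contains all of its elements.  The
-- list may also have entries outside of the subset: classically, a
-- subset of a finite set is finite.
Finite : {X : Set} → Pred X 0ℓ → Set
Finite {X} P = Σ[ xs ∈ List X ] (∀ {x} → x ∈ P → x ∈ₗ xs)

-- The vertices form a subset V of an ambient type X.  Sub-1-charts, and
-- the results of eliminating loops, are then 1-charts over the same X,
-- and the vertices of a chart interpretation are a set of star
-- expressions.
record 1-Chart (A X : Set) : Set₁ where
  field
    V      : Pred X 0ℓ
    finite : Finite V
    start  : X
    start∈ : start ∈ V
    Tr     : X → Label A → X → Set
    source : ∀ {v l w} → Tr v l w → v ∈ V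
    target : ∀ {v l w} → Tr v l w → w ∈ V
    Term   : Pred X 0ℓ
    term∈  : Term ⊆ V

  Step : X → X → Set
  Step v w = ∃[ l ] Tr v l w

  InfinitePathFrom : X → (ℕ → X) → Set
  InfinitePathFrom v π = π zero ≡ v × (∀ n → Step (π n) (π (suc n)))

  HasInfinitePath : Set
  HasInfinitePath = ∃[ v ] ∃[ π ] InfinitePathFrom v π

  InducedTr : X → A → X → Set
  InducedTr v a w =
    ∃[ u ] Star (λ x y → Tr x one y) v u × Tr u (proper a) w

  InducedTerm : X → Set
  InducedTerm v = ∃[ u ] Star (λ x y → Tr x one y) v u × Term u

open 1-Chart

IsChart : ∀ {A X} → 1-Chart A X → Set
IsChart C = ∀ {v w} → ¬ Tr C v one w

module _ {A : Set} where

  _⟶_ : StExp A → StExp A → Set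
  e ⟶ f = ∃[ a ] e —[ a ]→ f

  -- A finite list of star expressions that contains e and is closed
  -- under transitions; it only serves to show that 𝒞 e is finite.
  closure : StExp A → List (StExp A)
  closure 𝟘       = 𝟘 ∷ []
  closure 𝟙       = 𝟙 ∷ []
  closure (act a) = act a ∷ 𝟙 ∷ []
  closure (e + f) = e + f ∷ closure e ++ closure f
  closure (e · f) = map (_· f) (closure e) ++ closure f
  closure (e *)   = e * ∷ map (_· e *) (closure e)

  closure-self : ∀ e → e ∈ₗ closure e
  closure-self 𝟘       = here refl
  closure-self 𝟙       = here refl
  closure-self (act a) = here refl
  closure-self (e + f) = here refl
  closure-self (e · f) = ∈-++⁺ˡ (∈-map⁺ (_· f) (closure-self e))
  closure-self (e *)   = here refl

  closure-step : ∀ e {f a g} → f ∈ₗ closure e → f —[ a ]→ g → g ∈ₗ closure e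
  closure-step 𝟘 (here refl) ()
  closure-step 𝟙 (here refl) ()
  closure-step (act a) (here refl) act→ = there (here refl)
  closure-step (act a) (there (here refl)) ()
  closure-step (e + f) (here refl) (+→ˡ s) =
    there (∈-++⁺ˡ (closure-step e (closure-self e) s))
  closure-step (e + f) (here refl) (+→ʳ s) =
    there (∈-++⁺ʳ (closure e) (closure-step f (closure-self f) s))
  closure-step (e + f) (there p) s with ∈-++⁻ (closure e) p
  ... | inj₁ q = there (∈-++⁺ˡ (closure-step e q s))
  ... | inj₂ q = there (∈-++⁺ʳ (closure e) (closure-step f q s))
  closure-step (e · f) p s with ∈-++⁻ (map (_· f) (closure e)) p
  closure-step (e · f) p s | inj₂ q =
    ∈-++⁺ʳ (map (_· f) (closure e)) (closure-step f q s)
  closure-step (e · f) p s | inj₁ q with ∈-map⁻ (_· f) q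
  closure-step (e · f) p (·→ˡ s)   | inj₁ q | e′ , r , refl =
    ∈-++⁺ˡ (∈-map⁺ (_· f) (closure-step e r s))
  closure-step (e · f) p (·→ʳ _ s) | inj₁ q | e′ , r , refl =
    ∈-++⁺ʳ (map (_· f) (closure e)) (closure-step f (closure-self f) s)
  closure-step (e *) (here refl) (*→ s) =
    there (∈-map⁺ (_· e *) (closure-step e (closure-self e) s))
  closure-step (e *) (there p) s with ∈-map⁻ (_· e *) p
  closure-step (e *) (there p) (·→ˡ s)       | e′ , r , refl =
    there (∈-map⁺ (_· e *) (closure-step e r s))
  closure-step (e *) (there p) (·→ʳ _ (*→ s)) | e′ , r , refl =
    there (∈-map⁺ (_· e *) (closure-step e (closure-self e) s))

  closure-reachable : ∀ e {f g} → f ∈ₗ closure e → Star _⟶_ f g → g ∈ₗ closure e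
  closure-reachable e p ε              = p
  closure-reachable e p ((_ , s) ◅ ss) =
    closure-reachable e (closure-step e p s) ss

  data 𝒞-Tr (e : StExp A) : StExp A → Label A → StExp A → Set where
    step : ∀ {f a g} → Star _⟶_ e f → f —[ a ]→ g → 𝒞-Tr e f (proper a) g

  𝒞 : StExp A → 1-Chart A (StExp A)
  𝒞 e = record
    { V      = Star _⟶_ e
    ; finite = closure e , closure-reachable e (closure-self e)
    ; start  = e
    ; start∈ = ε
    ; Tr     = 𝒞-Tr e
    ; source = λ { (step r _) → r }
    ; target = λ { (step r s) → r ◅◅ (_ , s) ◅ ε }
    ; Term   = λ f → Star _⟶_ e f × f ↓
    ; term∈  = proj₁
    }

  𝒞-isChart : ∀ e → IsChart (𝒞 e)
  𝒞-isChart e ()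

module _ {A X₁ X₂ : Set} (C₁ : 1-Chart A X₁) (C₂ : 1-Chart A X₂) where

  record Is1-Bisimulation (B : X₁ → X₂ → Set) : Set where
    field
      vertices    : ∀ {v₁ v₂} → B v₁ v₂ → v₁ ∈ V C₁ × v₂ ∈ V C₂
      starts      : B (start C₁) (start C₂)
      forth       : ∀ {v₁ v₂ a v₁′} → B v₁ v₂ → InducedTr C₁ v₁ a v₁′ →
                    ∃[ v₂′ ] InducedTr C₂ v₂ a v₂′ × B v₁′ v₂′
      back        : ∀ {v₁ v₂ a v₂′} → B v₁ v₂ → InducedTr C₂ v₂ a v₂′ →
                    ∃[ v₁′ ] InducedTr C₁ v₁ a v₁′ × B v₁′ v₂′
      termination : ∀ {v₁ v₂} → B v₁ v₂ → InducedTerm C₁ v₁ ⇔ InducedTerm C₂ v₂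

  -- B is the graph of a function V₁ → V₂.  (That the values lie in V₂
  -- is part of B being a 1-bisimulation.)
  IsFunctionGraph : (X₁ → X₂ → Set) → Set
  IsFunctionGraph B = (∀ {v₁} → v₁ ∈ V C₁ → ∃[ v₂ ] B v₁ v₂)
                    × (∀ {v₁ v₂ v₂′} → B v₁ v₂ → B v₁ v₂′ → v₂ ≡ v₂′)

  Functional1-Bisimulation : Set₁
  Functional1-Bisimulation =
    Σ[ B ∈ (X₁ → X₂ → Set) ] Is1-Bisimulation B × IsFunctionGraph B

record IsLoop {A X : Set} (C : 1-Chart A X) : Set where
  field
    L1 : ∃[ π ] InfinitePathFrom C (start C) π
    L2 : ∀ π → InfinitePathFrom C (start C) π → ∃[ n ] π (suc n) ≡ start C
    L3 : ∀ {v} → Term C v → v ≡ start C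

-- The sub-1-chart of C that is generated by a set U of transitions from
-- a vertex v: it consists of what lies on paths that start with a
-- transition in U and continue for as long as v is not reached again.
-- Such paths may also get stuck without returning to v.  Vertices that
-- are kept also keep their immediate termination.
module Generated {A X : Set} (C : 1-Chart A X) (v : X) (v∈ : v ∈ V C)
                 (U : Label A → X → Set) (U⊆ : ∀ {l w} → U l w → Tr C v l w) where

  data OnPath : X → Set where
    first : ∀ {l w} → U l w → OnPath w
    next  : ∀ {u l w} → OnPath u → u ≢ v → Tr C u l w → OnPath w

  data GenTr : X → Label A → X → Set where
    entry : ∀ {l w} → U l w → GenTr v l w
    body  : ∀ {u l w} → OnPath u → u ≢ v → Tr C u l w → GenTr u l w

  onPath∈ : OnPath ⊆ V C
  onPath∈ (first x)    = target C (U⊆ x)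
  onPath∈ (next _ _ t) = target C t

  GenV : Pred X 0ℓ
  GenV w = w ≡ v ⊎ OnPath w

  genV∈ : GenV ⊆ V C
  genV∈ (inj₁ refl) = v∈
  genV∈ (inj₂ p)    = onPath∈ p

  generated : 1-Chart A X
  generated = record
    { V      = GenV
    ; finite = proj₁ (finite C) , λ p → proj₂ (finite C) (genV∈ p)
    ; start  = v
    ; start∈ = inj₁ refl
    ; Tr     = GenTr
    ; source = λ { (entry _) → inj₁ refl ; (body p _ _) → inj₂ p }
    ; target = λ { (entry x) → inj₂ (first x) ; (body p n t) → inj₂ (next p n t) }
    ; Term   = λ w → GenV w × Term C w
    ; term∈  = proj₁
    }

record LoopSub1-Chart {A X : Set} (C : 1-Chart A X) : Set₁ where
  field
    vertex   : X
    vertex∈  : vertex ∈ V C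
    U        : Label A → X → Set
    U⊆       : ∀ {l w} → U l w → Tr C vertex l w
    nonempty : ∃[ l ] ∃[ w ] U l w

  loop : 1-Chart A X
  loop = Generated.generated C vertex vertex∈ U U⊆

  field
    isLoop : IsLoop loop

  LoopEntry : X → Label A → X → Set
  LoopEntry v l w = v ≡ vertex × U l w

  InBody : Pred X 0ℓ
  InBody w = w ∈ V loop × w ≢ vertex

open LoopSub1-Chart using (vertex; LoopEntry; InBody)

-- Simultaneous elimination of the loop sub-1-charts L zero, …, L n.
record MultiStep {A X : Set} (C : 1-Chart A X) : Set₁ where
  field
    n        : ℕ
    L        : Fin (suc n) → LoopSub1-Chart C
    disjoint : ∀ {i j} → i ≢ j → ∀ {v l w} →
               ¬ (LoopEntry (L i) v l w × LoopEntry (L j) v l w)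
    apart    : ∀ {i j} → i ≢ j → ¬ InBody (L j) (vertex (L i))

  Removed : X → Label A → X → Set
  Removed v l w = ∃[ i ] LoopEntry (L i) v l w

  Kept : X → Label A → X → Set
  Kept v l w = Tr C v l w × ¬ Removed v l w

  KeptStep : X → X → Set
  KeptStep v w = ∃[ l ] Kept v l w

  Reachable : Pred X 0ℓ
  Reachable = Star KeptStep (start C)

  reachable∈ : ∀ {v w} → v ∈ V C → Star KeptStep v w → w ∈ V C
  reachable∈ p ε                    = p
  reachable∈ p ((_ , (t , _)) ◅ ss) = reachable∈ (target C t) ss

  result : 1-Chart A X
  result = record
    { V      = Reachable
    ; finite = proj₁ (finite C) , λ r → proj₂ (finite C) (reachable∈ (start∈ C) r)
    ; start  = start C
    ; start∈ = ε
    ; Tr     = λ v l w → Reachable v × Kept v l w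
    ; source = proj₁
    ; target = λ { (r , k) → r ◅◅ (_ , k) ◅ ε }
    ; Term   = λ v → Reachable v × Term C v
    ; term∈  = proj₁
    }

open MultiStep using (L; Removed; result)

data Run {A X : Set} : 1-Chart A X → 1-Chart A X → Set₁ where
  []  : ∀ {C} → Run C C
  _∷_ : ∀ {C D} (M : MultiStep C) → Run (result M) D → Run C D

-- RemovedIn R n v l w: the transition is removed as a loop-entry
-- transition in the multi-step of R with index n, counting from zero.
RemovedIn : ∀ {A X} {C D : 1-Chart A X} → Run C D → ℕ → X → Label A → X → Set
RemovedIn []      n       v l w = ⊥
RemovedIn (M ∷ R) zero    v l w = Removed M v l w
RemovedIn (M ∷ R) (suc n) v l w = RemovedIn R n v l w

-- For loops in the same multi-step, the layering condition is 'apart'.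
Layered : ∀ {A X} {C D : 1-Chart A X} → Run C D → Set
Layered []      = ⊤
Layered (M ∷ R) =
  (∀ {n v l w} → RemovedIn R n v l w → ∀ i → ¬ InBody (L M i) v) × Layered R

-- Marking labels are given for all triples, but only their values on
-- the transitions of C matter.
record LLEE-Witness {A X : Set} (C : 1-Chart A X) : Set₁ where
  field
    label      : X → Label A → X → ℕ
    {final}    : 1-Chart A X
    run        : Run C final
    successful : ¬ HasInfinitePath final
    layered    : Layered run
    records    : ∀ {v l w} → Tr C v l w →
                 ∀ n → label v l w ≡ suc n ⇔ RemovedIn run n v l w

  Guarded : Set
  Guarded = ∀ {v l w} → Tr C v l w → label v l w ≢ 0 → ∃[ a ] l ≡ proper a

GuardedLLEE : ∀ {A X} → 1-Chart A X → Set₁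
GuardedLLEE C = Σ[ W ∈ LLEE-Witness C ] LLEE-Witness.Guarded W

{-# OPTIONS --safe #-}
module Submission where

open import Defs
open import Level using (0ℓ)
open import Axiom.ExcludedMiddle using (ExcludedMiddle)
open import Algebra.Bundles using (IdempotentCommutativeMonoid)
import Algebra.Solver.IdempotentCommutativeMonoid as ICMSolver
open import Data.Bool using (Bool; true; false; _∧_; _∨_; if_then_else_)
open import Data.Bool.Properties using (∨-zeroʳ)
open import Data.Empty using (⊥; ⊥-elim)
open import Data.Fin using (Fin)
open import Data.Fin.Properties using () renaming (_≟_ to _≟ᶠ_)
open import Data.List using (List; []; _∷_; _++_; filter; cartesianProduct; map)
open import Data.List.Membership.Propositional using () renaming (_∈_ to _∈ₗ_)
open import Data.List.Membership.Propositional.Properties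
  using (∈-filter⁺; ∈-filter⁻; ∈-cartesianProduct⁺; ∈-map⁺; ∈-++⁺ˡ; ∈-++⁺ʳ)
open import Data.List.Relation.Unary.Any using (here; there)
open import Data.Nat using (ℕ; zero; suc)
open import Data.Nat.Properties using (0≢1+n)
open import Data.Product using (Σ-syntax; ∃-syntax; _×_; _,_; proj₁; proj₂)
open import Data.Sum using (inj₁; inj₂)
open import Function.Bundles using (Equivalence)
open import Induction.WellFounded using (WellFounded; Acc; acc; module Subrelation)
open import Relation.Binary.Bundles using (Setoid)
open import Relation.Binary.Construct.Closure.ReflexiveTransitive
  using (Star; ε; _◅_; _◅◅_)
open import Relation.Binary.PropositionalEquality
  using (_≡_; _≢_; refl; sym; trans; cong; subst)
import Relation.Binary.Reasoning.Setoid as SetoidReasoning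
open import Relation.Nullary using (¬_; Dec; yes; no; does; ¬?)
open import Relation.Unary using (_∈_)

open 1-Chart
open LoopSub1-Chart using (vertex; U; U⊆; isLoop; InBody)
open MultiStep using (L; apart; Removed; Reachable; result)

-- A 1-chart is read as a system of equations, with one equation
-- s v = prefix v · s v + (output v + ∑ l · s w) per vertex v.  In the body of
-- a loop at v, which is acyclic and does not terminate, the equations give
-- s w = t w · s v for an expression t w.  Eliminating the loop therefore
-- amounts to moving its entry transitions into prefix v, and this preserves
-- guardedness because the entries are proper.  Solutions can be carried both
-- ways through a multi-step; the 1-chart without infinite paths at the end of
-- a run is solved by well-founded recursion, and uniquely so by RSP*.  Hence
-- every guarded LLEE-1-chart has a solution, and any two solutions agree at
-- its start vertex.
--
-- (i) The functions from C to 𝒞 e₁ and 𝒞 e₂ are themselves solutions of C.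
-- (ii) A solution of C composed with the function from 𝒞 eᵢ to C solves 𝒞 eᵢ,
-- and 𝒞 e has a unique solution for every e, by induction on e.

-- Milner's system

module _ {A : Set} where

  milSetoid : Setoid 0ℓ 0ℓ
  milSetoid = record
    { Carrier       = StExp A
    ; _≈_           = _=Mil_
    ; isEquivalence = record
      { refl = reflexivity ; sym = symmetry ; trans = transitivity }
    }

  open SetoidReasoning milSetoid

  private variable
    e e′ f f′ g h : StExp A

  ≡⇒=Mil : e ≡ f → e =Mil f
  ≡⇒=Mil refl = reflexivity

  +-cong : e =Mil e′ → f =Mil f′ → e + f =Mil e′ + f′
  +-cong {e} {e′} {f} {f′} p q =
    transitivity (context (□ +ˡ f) p) (context (e′ +ʳ □) q)

  +-congˡ : f =Mil f′ → e + f =Mil e + f′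
  +-congˡ = +-cong reflexivity

  +-congʳ : e =Mil e′ → e + f =Mil e′ + f
  +-congʳ p = +-cong p reflexivity

  ·-congˡ : f =Mil f′ → e · f =Mil e · f′
  ·-congˡ {e = e} = context (e ·ʳ □)

  ·-congʳ : e =Mil e′ → e · f =Mil e′ · f
  ·-congʳ {f = f} = context (□ ·ˡ f)

  *-cong : e =Mil f → e * =Mil f *
  *-cong = context (□ ⋆)

  +-identityˡ : 𝟘 + e =Mil e
  +-identityˡ = transitivity +-comm +-identity

  +-idempotentCommutativeMonoid : IdempotentCommutativeMonoid 0ℓ 0ℓ
  +-idempotentCommutativeMonoid = record
    { Carrier = StExp A ; _≈_ = _=Mil_ ; _∙_ = _+_ ; ε = 𝟘
    ; isIdempotentCommutativeMonoid = record
      { isCommutativeMonoid = record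
        { isMonoid = record
          { isSemigroup = record
            { isMagma = record
              { isEquivalence = Setoid.isEquivalence milSetoid
              ; ∙-cong = +-cong }
            ; assoc = λ _ _ _ → +-assoc }
          ; identity = (λ _ → +-identityˡ) , (λ _ → +-identity) }
        ; comm = λ _ _ → +-comm }
      ; idem = λ _ → +-idem } }

  open ICMSolver +-idempotentCommutativeMonoid
    using (solve; _⊕_; _⊜_)

  -- The order induced by sums

  infix 4 _⊑_

  -- The semilattice order of `+`. Sums over transitions are compared by proving two inequalities,
  -- which frees the calculations from the order and multiplicity of summands.
  _⊑_ : StExp A → StExp A → Set
  e ⊑ f = e + f =Mil f

  ⊑-reflexive : e =Mil f → e ⊑ f
  ⊑-reflexive p = transitivity (+-congʳ p) +-idem

  ⊑-trans : e ⊑ f → f ⊑ g → e ⊑ g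
  ⊑-trans {e} {f} {g} p q = begin
    e + g        ≈⟨ +-congˡ (symmetry q) ⟩
    e + (f + g)  ≈⟨ symmetry +-assoc ⟩
    (e + f) + g  ≈⟨ +-congʳ p ⟩
    f + g        ≈⟨ q ⟩
    g            ∎

  ⊑-antisym : e ⊑ f → f ⊑ e → e =Mil f
  ⊑-antisym p q = transitivity (symmetry q) (transitivity +-comm p)

  +-upperˡ : e ⊑ e + f
  +-upperˡ {e} {f} = solve 2 (λ x y → x ⊕ (x ⊕ y) ⊜ x ⊕ y) reflexivity e f

  +-upperʳ : f ⊑ e + f
  +-upperʳ {f} {e} = solve 2 (λ x y → y ⊕ (x ⊕ y) ⊜ x ⊕ y) reflexivity e f

  +-least : e ⊑ g → f ⊑ g → e + f ⊑ g
  +-least p q = transitivity +-assoc (transitivity (+-congˡ q) p)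

  𝟘-least : 𝟘 ⊑ e
  𝟘-least = +-identityˡ

  infixr 6 _▸_

  _▸_ : Bool → StExp A → StExp A
  b ▸ e = if b then e else 𝟘

  ▸-cong : ∀ b → e =Mil f → b ▸ e =Mil b ▸ f
  ▸-cong true  p = p
  ▸-cong false p = reflexivity

  ▸-· : ∀ b → (b ▸ e) · f =Mil b ▸ e · f
  ▸-· true  = reflexivity
  ▸-· false = ·-zeroˡ

  ▸-∨ : ∀ b c → (b ∨ c) ▸ e =Mil (b ▸ e) + (c ▸ e)
  ▸-∨ true  true  = symmetry +-idem
  ▸-∨ true  false = symmetry +-identity
  ▸-∨ false c     = symmetry +-identityˡ

  -- Termination and derivatives

  terminates : StExp A → Bool
  terminates 𝟘       = false
  terminates 𝟙       = true
  terminates (act a) = false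
  terminates (e + f) = terminates e ∨ terminates f
  terminates (e · f) = terminates e ∧ terminates f
  terminates (e *)   = true

  terminates-complete : e ↓ → terminates e ≡ true
  terminates-complete 𝟙↓      = refl
  terminates-complete (+↓ˡ p) rewrite terminates-complete p = refl
  terminates-complete (+↓ʳ p) rewrite terminates-complete p = ∨-zeroʳ _
  terminates-complete (·↓ p q)
    rewrite terminates-complete p | terminates-complete q = refl
  terminates-complete *↓      = refl

  terminates-sound : ∀ e → terminates e ≡ true → e ↓
  terminates-sound 𝟙       p = 𝟙↓
  terminates-sound (e + f) p with terminates e in eq
  ... | true  = +↓ˡ (terminates-sound e eq)
  ... | false = +↓ʳ (terminates-sound f p)
  terminates-sound (e · f) p with terminates e in eq
  ... | true  = ·↓ (terminates-sound e eq) (terminates-sound f p)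
  terminates-sound (e *)   p = *↓

  -- derivatives s e is the sum of all a · s e′ for transitions e —[ a ]→ e′.
  derivatives : (StExp A → StExp A) → StExp A → StExp A
  derivatives s 𝟘       = 𝟘
  derivatives s 𝟙       = 𝟘
  derivatives s (act a) = act a · s 𝟙
  derivatives s (e + f) = derivatives s e + derivatives s f
  derivatives s (e · f) =
    derivatives (λ x → s (x · f)) e + (terminates e ▸ derivatives s f)
  derivatives s (e *)   = derivatives (λ x → s (x · e *)) e

  private variable
    s t : StExp A → StExp A

  derivatives-cong : ∀ e → (∀ {a e′} → e —[ a ]→ e′ → s e′ =Mil t e′) →
                     derivatives s e =Mil derivatives t e
  derivatives-cong 𝟘       p = reflexivity
  derivatives-cong 𝟙       p = reflexivity
  derivatives-cong (act a) p = ·-congˡ (p act→)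
  derivatives-cong (e + f) p =
    +-cong (derivatives-cong e λ q → p (+→ˡ q))
           (derivatives-cong f λ q → p (+→ʳ q))
  derivatives-cong (e · f) p with terminates e in eq
  ... | true  = +-cong (derivatives-cong e λ q → p (·→ˡ q))
                  (derivatives-cong f λ q → p (·→ʳ (terminates-sound e eq) q))
  ... | false = +-congʳ (derivatives-cong e λ q → p (·→ˡ q))
  derivatives-cong (e *)   p = derivatives-cong e λ q → p (*→ q)

  -- The factor leaves each summand by associativity and the sum by right distributivity.
  derivatives-· : ∀ e → derivatives (λ x → s x · g) e =Mil derivatives s e · g
  derivatives-· 𝟘       = symmetry ·-zeroˡ
  derivatives-· 𝟙       = symmetry ·-zeroˡ
  derivatives-· (act a) = symmetry ·-assoc
  derivatives-· (e + f) =
    transitivity (+-cong (derivatives-· e) (derivatives-· f))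
                 (symmetry ·-distrib-+)
  derivatives-· {s} {g} (e · f) = begin
    derivatives (λ x → s (x · f) · g) e
      + (terminates e ▸ derivatives (λ x → s x · g) f)
        ≈⟨ +-cong (derivatives-· e) (▸-cong (terminates e) (derivatives-· f)) ⟩
    derivatives (λ x → s (x · f)) e · g
      + (terminates e ▸ derivatives s f · g)
        ≈⟨ +-congˡ (symmetry (▸-· (terminates e))) ⟩
    derivatives (λ x → s (x · f)) e · g
      + (terminates e ▸ derivatives s f) · g
        ≈⟨ symmetry ·-distrib-+ ⟩
    derivatives s (e · f) · g ∎
  derivatives-· (e *)   = derivatives-· e

  derivatives-upper : ∀ {a} → e —[ a ]→ e′ → act a · s e′ ⊑ derivatives s e
  derivatives-upper act→      = +-idem
  derivatives-upper (+→ˡ p)   = ⊑-trans (derivatives-upper p) +-upperˡ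
  derivatives-upper (+→ʳ p)   = ⊑-trans (derivatives-upper p) +-upperʳ
  derivatives-upper {s = s} (·→ˡ {f = f} p) =
    ⊑-trans (derivatives-upper {s = λ x → s (x · f)} p) +-upperˡ
  derivatives-upper (·→ʳ d p) rewrite terminates-complete d =
    ⊑-trans (derivatives-upper p) +-upperʳ
  derivatives-upper {s = s} (*→ {e = e} p) =
    derivatives-upper {s = λ x → s (x · e *)} p

  derivatives-least : ∀ e → (∀ {a e′} → e —[ a ]→ e′ → act a · s e′ ⊑ h) →
                      derivatives s e ⊑ h
  derivatives-least 𝟘       p = 𝟘-least
  derivatives-least 𝟙       p = 𝟘-least
  derivatives-least (act a) p = p act→
  derivatives-least (e + f) p =
    +-least (derivatives-least e λ q → p (+→ˡ q))
            (derivatives-least f λ q → p (+→ʳ q))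
  derivatives-least (e · f) p with terminates e in eq
  ... | true  = +-least (derivatives-least e λ q → p (·→ˡ q))
                  (derivatives-least f λ q → p (·→ʳ (terminates-sound e eq) q))
  ... | false = +-least (derivatives-least e λ q → p (·→ˡ q)) 𝟘-least
  derivatives-least (e *)   p = derivatives-least e λ q → p (*→ q)

  -- Every nonzero summand starts with an action. This supplies the side condition of `RSP*` in the
  -- star case below.
  derivatives-guarded : ∀ e → ¬ derivatives s e ↓
  derivatives-guarded (act a) (·↓ () _)
  derivatives-guarded (e + f) (+↓ˡ p) = derivatives-guarded e p
  derivatives-guarded (e + f) (+↓ʳ p) = derivatives-guarded f p
  derivatives-guarded (e · f) (+↓ˡ p) = derivatives-guarded e p
  derivatives-guarded (e · f) (+↓ʳ p) with terminates e
  ... | true = derivatives-guarded f p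
  derivatives-guarded (e · f) (+↓ʳ ()) | false
  derivatives-guarded (e *)   p       = derivatives-guarded e p

  -- The fundamental theorem and unique solvability of chart interpretations

  mutual
    fundamental : ∀ e → e =Mil derivatives (λ x → x) e + (terminates e ▸ 𝟙)
    fundamental 𝟘       = symmetry +-idem
    fundamental 𝟙       = symmetry +-identityˡ
    fundamental (act a) =
      symmetry (transitivity +-identity ·-identityʳ)
    fundamental (e + f) = begin
      e + f ≈⟨ +-cong (fundamental e) (fundamental f) ⟩
      (De + Te) + (Df + Tf)
        ≈⟨ solve 4 (λ x y z w → (x ⊕ y) ⊕ (z ⊕ w) ⊜ (x ⊕ z) ⊕ (y ⊕ w))
             reflexivity De Te Df Tf ⟩
      (De + Df) + (Te + Tf)
        ≈⟨ +-congˡ (symmetry (▸-∨ (terminates e) (terminates f))) ⟩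
      (De + Df) + ((terminates e ∨ terminates f) ▸ 𝟙) ∎
      where
      De = derivatives (λ x → x) e
      Df = derivatives (λ x → x) f
      Te = terminates e ▸ 𝟙
      Tf = terminates f ▸ 𝟙
    fundamental (e · f) = begin
      e · f ≈⟨ fundamental-· e ⟩
      derivatives (_· f) e + (terminates e ▸ f)
        ≈⟨ +-congˡ (lemma (terminates e)) ⟩
      derivatives (_· f) e
        + ((terminates e ▸ Df) + ((terminates e ∧ terminates f) ▸ 𝟙))
        ≈⟨ symmetry +-assoc ⟩
      (derivatives (_· f) e + (terminates e ▸ Df))
        + ((terminates e ∧ terminates f) ▸ 𝟙) ∎
      where
      Df = derivatives (λ x → x) f
      lemma : ∀ b → b ▸ f =Mil (b ▸ Df) + ((b ∧ terminates f) ▸ 𝟙)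
      lemma true  = fundamental f
      lemma false = symmetry +-idem
    fundamental (e *) = begin
      e *                          ≈⟨ *-derivatives e ⟩
      D *                          ≈⟨ *-unfold ⟩
      𝟙 + D · D *                  ≈⟨ +-comm ⟩
      D · D * + 𝟙                  ≈⟨ +-congʳ (·-congˡ (symmetry (*-derivatives e))) ⟩
      D · e * + 𝟙                  ≈⟨ +-congʳ (symmetry (derivatives-· e)) ⟩
      derivatives (_· e *) e + 𝟙   ∎
      where D = derivatives (λ x → x) e

    fundamental-· : ∀ e → e · g =Mil derivatives (_· g) e + (terminates e ▸ g)
    fundamental-· {g} e = begin
      e · g                  ≈⟨ ·-congʳ (fundamental e) ⟩
      (D + (terminates e ▸ 𝟙)) · g
                             ≈⟨ ·-distrib-+ ⟩
      D · g + (terminates e ▸ 𝟙) · g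
        ≈⟨ +-cong (symmetry (derivatives-· e))
             (transitivity (▸-· (terminates e)) (▸-cong (terminates e) ·-identityˡ)) ⟩
      derivatives (_· g) e + (terminates e ▸ g) ∎
      where D = derivatives (λ x → x) e

    -- If `e` terminates, its summand `𝟙` is absorbed by the axiom `*-𝟙+`. The body that remains
    -- does not terminate, as `RSP*` demands.
    *-derivatives : ∀ e → e * =Mil derivatives (λ x → x) e *
    *-derivatives e = transitivity (*-cong (fundamental e)) (lemma (terminates e))
      where
      D = derivatives (λ x → x) e
      lemma : ∀ b → (D + (b ▸ 𝟙)) * =Mil D *
      lemma true  = transitivity (*-cong +-comm) (symmetry *-𝟙+)
      lemma false = *-cong +-identity

  -- A solution s of the equations of a set Q of expressions, with 𝟙 replaced
  -- by the continuation g, is x ↦ x · g.  The set Q is a parameter because the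
  -- induction on e passes to the sets of all x with x · f ∈ Q.
  mutual
    solution-of-derivatives :
      ∀ e (Q : StExp A → Set) →
      (∀ {x a y} → Q x → x —[ a ]→ y → Q y) →
      (∀ {x} → Q x → s x =Mil derivatives s x + (terminates x ▸ g)) →
      (∀ {a x} → e —[ a ]→ x → Q x) →
      ∀ {a x} → e —[ a ]→ x → s x =Mil x · g
    solution-of-derivatives (act a) Q closed sol sub act→ =
      transitivity (sol (sub act→))
        (transitivity +-identityˡ (symmetry ·-identityˡ))
    solution-of-derivatives (e + f) Q closed sol sub (+→ˡ p) =
      solution-of-derivatives e Q closed sol (λ q → sub (+→ˡ q)) p
    solution-of-derivatives (e + f) Q closed sol sub (+→ʳ p) =
      solution-of-derivatives f Q closed sol (λ q → sub (+→ʳ q)) p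
    solution-of-derivatives {s} {g} (e · f) Q closed sol sub (·→ˡ p) =
      transitivity
        (solution-of-derivatives e (λ x → Q (x · f))
          (λ q r → closed q (·→ˡ r)) sol′ (λ q → sub (·→ˡ q)) p)
        (symmetry ·-assoc)
      where
      sol′ : ∀ {x} → Q (x · f) →
             s (x · f) =Mil
             derivatives (λ y → s (y · f)) x + (terminates x ▸ f · g)
      sol′ {x} q = begin
        s (x · f) ≈⟨ sol q ⟩
        (D + (terminates x ▸ derivatives s f))
          + ((terminates x ∧ terminates f) ▸ g) ≈⟨ +-assoc ⟩
        D + ((terminates x ▸ derivatives s f)
          + ((terminates x ∧ terminates f) ▸ g)) ≈⟨ +-congˡ lemma ⟩
        D + (terminates x ▸ f · g) ∎
        where
        D = derivatives (λ y → s (y · f)) x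
        -- For terminating `x` these two summands form the right-hand side at `f` with continuation
        -- `g`, so they equal `f · g`, the continuation for `e`.
        lemma : (terminates x ▸ derivatives s f)
                + ((terminates x ∧ terminates f) ▸ g)
                =Mil terminates x ▸ f · g
        lemma with terminates x in eq
        ... | true  = solution-of-expression f Q closed sol
                        λ r → closed q (·→ʳ (terminates-sound x eq) r)
        ... | false = +-idem
    solution-of-derivatives (e · f) Q closed sol sub (·→ʳ d p) =
      solution-of-derivatives f Q closed sol (λ q → sub (·→ʳ d q)) p
    solution-of-derivatives {s} {g} (e *) Q closed sol sub (*→ p) =
      transitivity (factor p)
        (transitivity (·-congˡ k=) (symmetry ·-assoc))
      where
      D = derivatives (λ x → x) e
      s′ = λ x → s (x · e *)
      -- The right-hand side of the equation at `e *`. It acts as the continuation of the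
      -- expressions `x` that occur in `x · e *`.
      k = derivatives s′ e + g

      sol′ : ∀ {x} → Q (x · e *) →
             s′ x =Mil derivatives s′ x + (terminates x ▸ k)
      sol′ {x} q = begin
        s′ x ≈⟨ sol q ⟩
        (derivatives s′ x + (terminates x ▸ derivatives s′ e))
          + ((terminates x ∧ true) ▸ g) ≈⟨ +-assoc ⟩
        derivatives s′ x + ((terminates x ▸ derivatives s′ e)
          + ((terminates x ∧ true) ▸ g)) ≈⟨ +-congˡ (lemma (terminates x)) ⟩
        derivatives s′ x + (terminates x ▸ k) ∎
        where
        lemma : ∀ b → (b ▸ derivatives s′ e) + ((b ∧ true) ▸ g) =Mil b ▸ k
        lemma true  = reflexivity
        lemma false = +-idem

      factor : ∀ {a x} → e —[ a ]→ x → s′ x =Mil x · k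
      factor = solution-of-derivatives e (λ x → Q (x · e *))
        (λ q r → closed q (·→ˡ r)) sol′ (λ q → sub (*→ q))

      -- Since `s′ x` equals `x · k` at the successors of `e`, `k` satisfies `k = D · k + g` with
      -- `D` guarded.
      k= : k =Mil e * · g
      k= = transitivity
        (RSP* (derivatives-guarded e)
          (+-congʳ (transitivity (derivatives-cong e factor) (derivatives-· e))))
        (·-congʳ (symmetry (*-derivatives e)))

    -- Stated for the right-hand side at `e` instead of `s e`, because only the successors of `e`
    -- are known to lie in `Q`.
    solution-of-expression :
      ∀ e (Q : StExp A → Set) →
      (∀ {x a y} → Q x → x —[ a ]→ y → Q y) →
      (∀ {x} → Q x → s x =Mil derivatives s x + (terminates x ▸ g)) →
      (∀ {a x} → e —[ a ]→ x → Q x) →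
      derivatives s e + (terminates e ▸ g) =Mil e · g
    solution-of-expression e Q closed sol sub =
      transitivity
        (+-congʳ (derivatives-cong e (solution-of-derivatives e Q closed sol sub)))
        (symmetry (fundamental-· e))

  -- Expressions as least upper bounds of their transitions

  actions : StExp A → List A
  actions 𝟘       = []
  actions 𝟙       = []
  actions (act a) = a ∷ []
  actions (e + f) = actions e ++ actions f
  actions (e · f) = actions e ++ actions f
  actions (e *)   = actions e

  ∈-actions : ∀ {e a f} → e —[ a ]→ f → a ∈ₗ actions e
  ∈-actions act→                  = here refl
  ∈-actions (+→ˡ p)               = ∈-++⁺ˡ (∈-actions p)
  ∈-actions (+→ʳ {e = e} p)       = ∈-++⁺ʳ (actions e) (∈-actions p)
  ∈-actions (·→ˡ p)               = ∈-++⁺ˡ (∈-actions p)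
  ∈-actions (·→ʳ {e₁} _ p)        = ∈-++⁺ʳ (actions e₁) (∈-actions p)
  ∈-actions (*→ p)                = ∈-actions p

  expansion : (StExp A → StExp A) → StExp A → StExp A
  expansion s e = derivatives s e + (terminates e ▸ 𝟙)

  module _ {s : StExp A → StExp A} where

    expansion-upper-→ : ∀ {e a e′} → e —[ a ]→ e′ → act a · s e′ ⊑ expansion s e
    expansion-upper-→ p = ⊑-trans (derivatives-upper p) +-upperˡ

    expansion-upper-↓ : ∀ {e} → e ↓ → 𝟙 ⊑ expansion s e
    expansion-upper-↓ d rewrite terminates-complete d = +-upperʳ

    expansion-least : ∀ {e h} → (e ↓ → 𝟙 ⊑ h) →
      (∀ {a e′} → e —[ a ]→ e′ → act a · s e′ ⊑ h) → expansion s e ⊑ h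
    expansion-least {e} {h} p q = +-least (derivatives-least e q) lemma
      where
      lemma : (terminates e ▸ 𝟙) ⊑ h
      lemma with terminates e in eq
      ... | true  = p (terminates-sound e eq)
      ... | false = 𝟘-least

  act·⊑ : ∀ {e a e′} → e —[ a ]→ e′ → act a · e′ ⊑ e
  act·⊑ {e} p = ⊑-trans (expansion-upper-→ p) (⊑-reflexive (symmetry (fundamental e)))

  𝟙⊑ : ∀ {e} → e ↓ → 𝟙 ⊑ e
  𝟙⊑ {e} d = ⊑-trans (expansion-upper-↓ d) (⊑-reflexive (symmetry (fundamental e)))

  -- By the fundamental theorem `e` is the least upper bound of its termination and its transitions;
  -- together with `act·⊑` and `𝟙⊑` this reduces inequalities to transfer along bisimulations.
  ⊑-by-transitions : ∀ {e h} → (e ↓ → 𝟙 ⊑ h) →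
    (∀ {a e′} → e —[ a ]→ e′ → act a · e′ ⊑ h) → e ⊑ h
  ⊑-by-transitions {e} p q = ⊑-trans (⊑-reflexive (fundamental e)) (expansion-least p q)

  𝒞-induced-tr : ∀ {e f g : StExp A} {a} → InducedTr (𝒞 e) f a g → f —[ a ]→ g
  𝒞-induced-tr (_ , ε , step _ p) = p

  𝒞-induced-term : ∀ {e f : StExp A} → InducedTerm (𝒞 e) f → f ↓
  𝒞-induced-term (_ , ε , _ , d) = d

-- Systems of equations

module _ {A : Set} where

  open SetoidReasoning (milSetoid {A})

  ⟦_⟧ : Label A → StExp A
  ⟦ one ⟧      = 𝟙
  ⟦ proper a ⟧ = act a

  ∑ : {B : Set} → List B → (B → StExp A) → StExp A
  ∑ []       F = 𝟘
  ∑ (x ∷ xs) F = F x + ∑ xs F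

  module _ {B : Set} {F : B → StExp A} where

    ∑-cong : ∀ {G} xs → (∀ {x} → x ∈ₗ xs → F x =Mil G x) → ∑ xs F =Mil ∑ xs G
    ∑-cong []       p = reflexivity
    ∑-cong (x ∷ xs) p = +-cong (p (here refl)) (∑-cong xs λ q → p (there q))

    ∑-upper : ∀ {xs x} → x ∈ₗ xs → F x ⊑ ∑ xs F
    ∑-upper (here refl) = +-upperˡ
    ∑-upper (there q)   = ⊑-trans (∑-upper q) +-upperʳ

    ∑-least : ∀ {h} xs → (∀ {x} → x ∈ₗ xs → F x ⊑ h) → ∑ xs F ⊑ h
    ∑-least []       p = 𝟘-least
    ∑-least (x ∷ xs) p = +-least (p (here refl)) (∑-least xs λ q → p (there q))

    ∑-guarded : ∀ xs → (∀ {x} → x ∈ₗ xs → ¬ F x ↓) → ¬ ∑ xs F ↓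
    ∑-guarded (x ∷ xs) p (+↓ˡ q) = p (here refl) q
    ∑-guarded (x ∷ xs) p (+↓ʳ q) = ∑-guarded xs (λ r → p (there r)) q

  ∑-· : {B : Set} {F : B → StExp A} {g : StExp A} → ∀ xs →
        ∑ xs F · g =Mil ∑ xs λ x → F x · g
  ∑-· []       = ·-zeroˡ
  ∑-· (x ∷ xs) = transitivity ·-distrib-+ (+-congˡ (∑-· xs))

  ∑-partition : {B : Set} {F : B → StExp A} {Q : B → Set} (Q? : ∀ x → Dec (Q x)) →
    ∀ xs → ∑ xs F =Mil ∑ (filter Q? xs) F + ∑ (filter (λ x → ¬? (Q? x)) xs) F
  ∑-partition {F = F} {Q} Q? xs = ⊑-antisym
    (∑-least xs λ {x} p → in-part p (Q? x))
    (+-least (∑-least ys λ p → ∑-upper {xs = xs} (proj₁ (∈-filter⁻ Q? p)))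
             (∑-least zs λ p → ∑-upper {xs = xs} (proj₁ (∈-filter⁻ ¬Q? {xs = xs} p))))
    where
    ¬Q? = λ x → ¬? (Q? x)
    ys  = filter Q? xs
    zs  = filter ¬Q? xs
    in-part : ∀ {x} → x ∈ₗ xs → Dec (Q x) → F x ⊑ ∑ ys F + ∑ zs F
    in-part p (yes q) = ⊑-trans (∑-upper (∈-filter⁺ Q? p q)) +-upperˡ
    in-part p (no ¬q) = ⊑-trans (∑-upper (∈-filter⁺ ¬Q? p ¬q)) +-upperʳ

-- prefix v accumulates the loops that have been eliminated at v.
record System (A X : Set) : Set where
  field
    prefix         : X → StExp A
    prefix-guarded : ∀ v → ¬ prefix v ↓
    output         : X → StExp A
    out            : X → List (Label A × X)

  infixl 5 _after_

  _after_ : (X → StExp A) → Label A × X → StExp A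
  s after (l , w) = ⟦ l ⟧ · s w

  remainder : (X → StExp A) → X → StExp A
  remainder s v = output v + ∑ (out v) (s after_)

  SolvesAt : (X → StExp A) → X → Set
  SolvesAt s v = s v =Mil prefix v · s v + remainder s v

  -- The equation at `v` with its self-reference resolved by iteration. Only values at successors
  -- remain, so recursion along transitions applies.
  solved : (X → StExp A) → X → StExp A
  solved s v = prefix v * · remainder s v

  remainder-cong : ∀ {s t} v → (∀ {l w} → (l , w) ∈ₗ out v → s w =Mil t w) →
                   remainder s v =Mil remainder t v
  remainder-cong v p = +-congˡ (∑-cong (out v) λ q → ·-congˡ (p q))

  solved-cong : ∀ {s t} v → (∀ {l w} → (l , w) ∈ₗ out v → s w =Mil t w) →
                solved s v =Mil solved t v
  solved-cong v p = ·-congˡ (remainder-cong v p)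

  solvesAt⇒solved : ∀ {s v} → SolvesAt s v → s v =Mil solved s v
  solvesAt⇒solved {v = v} p = RSP* (prefix-guarded v) p

  solved⇒solvesAt : ∀ {s v} → s v =Mil solved s v → SolvesAt s v
  solved⇒solvesAt {s} {v} p =
    transitivity p
      (transitivity (·-congʳ *-unfold)
      (transitivity ·-distrib-+
      (transitivity +-comm
        (+-cong (transitivity ·-assoc (·-congˡ (symmetry p))) ·-identityˡ))))

Reach : ∀ {A X} → 1-Chart A X → X → Set
Reach C = Star (Step C) (start C)

-- The link between chart and equations that is preserved by loop elimination; `prefix` is left free
-- because it grows along a run.
record Presents {A X : Set} (C : 1-Chart A X) (S : System A X) : Set where
  open System S
  field
    out-sound    : ∀ {v l w} → Reach C v → (l , w) ∈ₗ out v → Tr C v l w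
    out-complete : ∀ {v l w} → Reach C v → Tr C v l w → (l , w) ∈ₗ out v
    output-𝟘     : ∀ {v} → Reach C v → ¬ Term C v → output v ≡ 𝟘

Solution : ∀ {A X} → 1-Chart A X → System A X → (X → StExp A) → Set
Solution C S s = ∀ {v} → Reach C v → System.SolvesAt S s v

reach∈ : ∀ {A X} (C : 1-Chart A X) {v w} → v ∈ V C → Star (Step C) v w → w ∈ V C
reach∈ C p ε              = p
reach∈ C p ((_ , t) ◅ ts) = reach∈ C (target C t) ts

module _ {A X : Set} (C : 1-Chart A X) where

  one-then-induced-tr : ∀ {v u a w} → Tr C v one u → InducedTr C u a w → InducedTr C v a w
  one-then-induced-tr t (x , ts , p) = x , t ◅ ts , p

  one-then-induced-term : ∀ {v u} → Tr C v one u → InducedTerm C u → InducedTerm C v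
  one-then-induced-term t (x , ts , p) = x , t ◅ ts , p

  reach-step : ∀ {v l w} → Reach C v → Tr C v l w → Reach C w
  reach-step r t = r ◅◅ (_ , t) ◅ ε

  reach-induced : ∀ {v a w} → Reach C v → InducedTr C v a w → Reach C w
  reach-induced r (_ , ε , t)      = reach-step r t
  reach-induced r (x , t ◅ ts , p) = reach-induced (reach-step r t) (x , ts , p)

-- Well-founded recursion and acyclic systems

module Classical (em : ExcludedMiddle 0ℓ) where

  -- Excluded middle decides a Σ-type and thereby returns a witness, so the sequence is defined by
  -- plain recursion.
  descending-sequence : {X : Set} {_≺_ : X → X → Set} {x : X} → ¬ Acc _≺_ x →
    Σ[ π ∈ (ℕ → X) ] (π zero ≡ x × ∀ n → π (suc n) ≺ π n)
  descending-sequence {X} {_≺_} {x} ¬acc =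
    (λ n → proj₁ (seq n)) , refl , λ n → proj₁ (proj₂ (next (seq n)))
    where
    next : (y : Σ[ y ∈ X ] ¬ Acc _≺_ y) →
           Σ[ z ∈ X ] (z ≺ proj₁ y × ¬ Acc _≺_ z)
    next (y , ¬a) with em {Σ[ z ∈ X ] (z ≺ y × ¬ Acc _≺_ z)}
    ... | yes z = z
    ... | no ¬z = ⊥-elim (¬a (acc λ {z} z≺y → inaccessible z≺y em))
      where
      inaccessible : ∀ {z} → z ≺ y → Dec (Acc _≺_ z) → Acc _≺_ z
      inaccessible z≺y (yes a) = a
      inaccessible z≺y (no ¬a) = ⊥-elim (¬z (_ , z≺y , ¬a))

    seq : ℕ → Σ[ y ∈ X ] ¬ Acc _≺_ y
    seq zero    = x , ¬acc
    seq (suc n) = let (z , _ , ¬a) = next (seq n) in z , ¬a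

  -- `F` expects a total function, so recursive values are cut off to `𝟘` where `u ≺ w` fails.
  -- Values from different accessibility proofs are provably equal because `F` respects provable
  -- equality below `w`.
  wellFounded-fixpoint :
    {A X : Set} {_≺_ : X → X → Set} → WellFounded _≺_ →
    (F : X → (X → StExp A) → StExp A) →
    (∀ w {s t} → (∀ {u} → u ≺ w → s u =Mil t u) → F w s =Mil F w t) →
    Σ[ s ∈ (X → StExp A) ] (∀ w → s w =Mil F w s)
  wellFounded-fixpoint {A} {X} {_≺_} wf F F-cong =
    (λ w → rec (wf w)) , λ w → unfold (wf w)
    where
    mutual
      rec : ∀ {w} → Acc _≺_ w → StExp A
      rec {w} (acc rs) = F w λ u → below rs u em

      below : ∀ {w} → (∀ {u} → u ≺ w → Acc _≺_ u) → ∀ u → Dec (u ≺ w) → StExp A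
      below rs u (yes p) = rec (rs p)
      below rs u (no _)  = 𝟘

    irrelevant : ∀ {w} (a b : Acc _≺_ w) → rec a =Mil rec b
    irrelevant {w} (acc rs) (acc rs′) = F-cong w λ p → go p em
      where
      go : ∀ {u} → u ≺ w → (d : Dec (u ≺ w)) → below rs u d =Mil below rs′ u d
      go p (yes q) = irrelevant (rs q) (rs′ q)
      go p (no ¬q) = reflexivity

    unfold : ∀ {w} (a : Acc _≺_ w) → rec a =Mil F w λ u → rec (wf u)
    unfold {w} (acc rs) = F-cong w λ p → go p em
      where
      go : ∀ {u} → u ≺ w → (d : Dec (u ≺ w)) → below rs u d =Mil rec (wf u)
      go p (yes q) = irrelevant (rs q) (wf _)
      go p (no ¬q) = ⊥-elim (¬q p)

  solve-acyclic : {A X : Set} (S : System A X) (D : X → Set) →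
    let open System S in
    WellFounded (λ u w → D w × ∃[ l ] (l , u) ∈ₗ out w) →
    Σ[ s ∈ (X → StExp A) ]
      (∀ {w} → D w → s w =Mil solved s w) × (∀ {w} → ¬ D w → s w =Mil 𝟙)
  solve-acyclic {A} {X} S D wf =
    s , (λ {w} d → transitivity (s= w) (inside d)) ,
        (λ {w} ¬d → transitivity (s= w) (outside ¬d))
    where
    open System S

    F : X → (X → StExp A) → StExp A
    -- For a loop body `D`, the value `𝟙` outside makes the head the unit, so that the solution
    -- expresses the way from `w` to the head.
    F w s = if does (em {D w}) then solved s w else 𝟙

    F-cong : ∀ w {s t} → (∀ {u} → D w × (∃[ l ] (l , u) ∈ₗ out w) → s u =Mil t u) →
             F w s =Mil F w t
    F-cong w p with em {D w}
    ... | yes d = solved-cong w λ q → p (d , _ , q)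
    ... | no _  = reflexivity

    fixpoint = wellFounded-fixpoint wf F F-cong
    s = proj₁ fixpoint
    s= = proj₂ fixpoint

    inside : ∀ {s w} → D w → F w s =Mil solved s w
    inside {w = w} d with em {D w}
    ... | yes _ = reflexivity
    ... | no ¬d = ⊥-elim (¬d d)

    outside : ∀ {s w} → ¬ D w → F w s =Mil 𝟙
    outside {w = w} ¬d with em {D w}
    ... | yes d = ⊥-elim (¬d d)
    ... | no _  = reflexivity

  -- Loop elimination

  module Loop {A X : Set} {C : 1-Chart A X} (l : LoopSub1-Chart C) where

    open LoopSub1-Chart l using ()
      renaming (vertex to v; vertex∈ to v∈; U to entries; U⊆ to entries⊆)
    open Generated C v v∈ entries entries⊆

    _≺_ : X → X → Set
    u ≺ w = InBody l w × Step C w u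

    onPath : ∀ {w} → InBody l w → OnPath w
    onPath (inj₁ p , w≢v) = ⊥-elim (w≢v p)
    onPath (inj₂ p , _)   = p

    body-next : ∀ {u w} → u ≺ w → GenV u
    body-next (b , _ , t) = inj₂ (next (onPath b) (proj₂ b) t)

    body-output : ∀ {w} → InBody l w → ¬ Term C w
    body-output b t = proj₂ b (IsLoop.L3 (isLoop l) (proj₁ b , t))

    private
      cons : X → (ℕ → X) → ℕ → X
      cons x π zero    = x
      cons x π (suc n) = π n

      -- Induction on `OnPath` walks back to a loop-entry transition, adding to the front of the
      -- path only vertices other than `v` until `v` itself is reached.
      prepend : ∀ {w} → OnPath w → (π : ℕ → X) → π zero ≡ w →
        (∀ n → π n ≢ v) → (∀ n → Step generated (π n) (π (suc n))) →
        Σ[ ρ ∈ (ℕ → X) ] InfinitePathFrom generated v ρ × (∀ n → ρ (suc n) ≢ v)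
      prepend (first x) π refl π≢v steps =
        cons v π , (refl , λ { zero → _ , entry x ; (suc n) → steps n }) , π≢v
      prepend (next {u = u} p u≢v t) π refl π≢v steps =
        prepend p (cons u π) refl
          (λ { zero → u≢v ; (suc n) → π≢v n })
          (λ { zero → _ , body p u≢v t ; (suc n) → steps n })

    -- A descending sequence is an infinite path inside the body. Prolonged backwards to the head,
    -- it never returns there, against (L2).
    ≺-wellFounded : WellFounded _≺_
    ≺-wellFounded w with em {Acc _≺_ w}
    ... | yes a = a
    ... | no ¬a with descending-sequence ¬a
    ... | π , refl , π≺ with prepend (onPath (proj₁ (π≺ zero))) π refl
          (λ n → proj₂ (proj₁ (π≺ n)))
          (λ n → let (b , l′ , t) = π≺ n in l′ , body (onPath b) (proj₂ b) t)
    ... | ρ , path , ρ≢v = let (n , ρ≡v) = IsLoop.L2 (isLoop l) ρ path in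
                           ⊥-elim (ρ≢v n ρ≡v)

  -- Equations before and after a multi-step

  module Elimination {A X : Set} {C : 1-Chart A X} (M : MultiStep C)
    (entries-proper : ∀ {v l w} → Removed M v l w → ∃[ a ] l ≡ proper a)
    (S : System A X) (presents : Presents C S) where

    open System S
    open Presents presents
    open SetoidReasoning (milSetoid {A})

    C′ = result M

    head : Fin (suc (MultiStep.n M)) → X
    head i = vertex (L M i)

    InLoop : Fin (suc (MultiStep.n M)) → X → Set
    InLoop i = V (LoopSub1-Chart.loop (L M i))

    reachable⇒reach′ : ∀ {w} → Reachable M w → Reach C′ w
    reachable⇒reach′ = go ε
      where
      go : ∀ {u w} → Reachable M u → Star (MultiStep.KeptStep M) u w →
           Star (Step C′) u w
      go r ε              = ε
      go r ((l , k) ◅ ss) = (l , r , k) ◅ go (r ◅◅ (l , k) ◅ ε) ss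

    reachable⇒reach : ∀ {w} → Reachable M w → Reach C w
    reachable⇒reach = go
      where
      go : ∀ {u w} → Star (MultiStep.KeptStep M) u w → Star (Step C) u w
      go ε                    = ε
      go ((l , t , _) ◅ ss) = (l , t) ◅ go ss

    reach′⇒reachable : ∀ {w} → Reach C′ w → Reachable M w
    reach′⇒reachable = reach∈ C′ (start∈ C′)

    removed⇒tr : ∀ {v l w} → Removed M v l w → Tr C v l w
    removed⇒tr (i , refl , u) = U⊆ (L M i) u

    removed⇒inLoop : ∀ {v l w} (r : Removed M v l w) → InLoop (proj₁ r) w
    removed⇒inLoop (i , refl , u) = inj₂ (Generated.first u)

    head-not-in-body : ∀ i j → InBody (L M j) (head i) → ⊥
    head-not-in-body i j b with i ≟ᶠ j
    ... | yes refl = proj₂ b refl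
    ... | no i≢j   = apart M i≢j b

    body-not-removed : ∀ {i v l w} → InBody (L M i) v → ¬ Removed M v l w
    body-not-removed {i} b (j , refl , _) = head-not-in-body j i b

    inLoop-step : ∀ {i w l u} → InBody (L M i) w → Tr C w l u → InLoop i u
    inLoop-step {i} b t = Loop.body-next (L M i) (b , _ , t)

    data Located (w : X) : Set where
      kept   : Reachable M w → Located w
      inBody : ∀ i → Reachable M (head i) → InBody (L M i) w → Located w

    locate-inLoop : ∀ {i w} → Reachable M (head i) → InLoop i w → Located w
    locate-inLoop {i} {w} r p with em {w ≡ head i}
    ... | yes refl = kept r
    ... | no w≢    = inBody i r (p , w≢)

    locate-step : ∀ {w l u} → Located w → Tr C w l u → Located u
    locate-step {w} {l} {u} (kept r) t with em {Removed M w l u}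
    ... | yes d@(_ , refl , _) = locate-inLoop r (removed⇒inLoop d)
    ... | no ¬d                = kept (r ◅◅ (l , t , ¬d) ◅ ε)
    locate-step (inBody i r b) t = locate-inLoop r (inLoop-step b t)

    -- A path leaves the kept part only through a removed entry, and then remains in the body of
    -- that loop until the head, which is still reachable, is met again.
    locate : ∀ {w} → Reach C w → Located w
    locate = go (kept ε)
      where
      go : ∀ {u w} → Located u → Star (Step C) u w → Located w
      go p ε              = p
      go p ((_ , t) ◅ ts) = go (locate-step p t) ts

    InBodyᴿ : Fin (suc (MultiStep.n M)) → X → Set
    InBodyᴿ i w = InBody (L M i) w × Reach C w

    module _ (i : Fin (suc (MultiStep.n M))) where

      private
        acyclic : WellFounded (λ u w → InBodyᴿ i w × ∃[ l ] (l , u) ∈ₗ out w)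
        acyclic = Subrelation.wellFounded
          (λ { ((b , r) , l , p) → b , l , out-sound r p })
          (Loop.≺-wellFounded (L M i))

        solution = solve-acyclic S (InBodyᴿ i) acyclic

      -- For w in the loop i, solutions satisfy s w = round i w · s (head i).
      round : X → StExp A
      round = proj₁ solution

      round-body : ∀ {w} → InBodyᴿ i w → round w =Mil solved round w
      round-body = proj₁ (proj₂ solution)

      round-head : round (head i) =Mil 𝟙
      round-head = proj₂ (proj₂ solution) λ { ((_ , ≢) , _) → ≢ refl }

      -- The factor `g` can be pulled out of the equation at a body vertex because (L3) makes the
      -- output there `𝟘`.
      round-step : ∀ {s g w} → InBodyᴿ i w →
                   (∀ {l u} → (l , u) ∈ₗ out w → s u =Mil round u · g) →
                   solved s w =Mil round w · g
      round-step {s} {g} {w} (b , r) h = begin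
        prefix w * · (output w + ∑ (out w) (s after_))
          ≈⟨ ·-congˡ (+-cong output= (∑-cong (out w) λ p →
               transitivity (·-congˡ (h p)) (symmetry ·-assoc))) ⟩
        prefix w * · (output w · g + ∑ (out w) (λ x → (round after x) · g))
          ≈⟨ ·-congˡ (+-congˡ (symmetry (∑-· (out w)))) ⟩
        prefix w * · (output w · g + ∑ (out w) (round after_) · g)
          ≈⟨ ·-congˡ (symmetry ·-distrib-+) ⟩
        prefix w * · (remainder round w · g)
          ≈⟨ symmetry ·-assoc ⟩
        solved round w · g
          ≈⟨ ·-congʳ (symmetry (round-body (b , r))) ⟩
        round w · g ∎
        where
        output= : output w =Mil output w · g
        output= rewrite output-𝟘 r (Loop.body-output (L M i) b) = symmetry ·-zeroˡ

    removed? : ∀ v (x : Label A × X) → Dec (Removed M v (proj₁ x) (proj₂ x))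
    removed? v x = em

    removed kept′ : X → List (Label A × X)
    removed v = filter (removed? v) (out v)
    kept′ v   = filter (λ x → ¬? (removed? v x)) (out v)

    -- The decision carries the index of the loop that the transition enters, which selects the
    -- `round` to be used.
    entry : ∀ {v l w} → Dec (Removed M v l w) → StExp A
    entry {l = l} {w} (yes (i , _)) = ⟦ l ⟧ · round i w
    entry             (no _)        = 𝟘

    loops : X → StExp A
    loops v = ∑ (removed v) λ x → entry (removed? v x)

    loops-guarded : ∀ v → ¬ loops v ↓
    loops-guarded v = ∑-guarded (removed v) λ {x} p → entry-guarded (removed? v x)
      where
      entry-guarded : ∀ {v l w} (d : Dec (Removed M v l w)) → ¬ entry d ↓
      entry-guarded (yes d) p with entries-proper d
      entry-guarded (yes d) (·↓ () _) | _ , refl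

    S′ : System A X
    S′ = record
      { prefix         = λ v → prefix v + loops v
      ; prefix-guarded = λ { v (+↓ˡ p) → prefix-guarded v p
                           ; v (+↓ʳ p) → loops-guarded v p }
      ; output         = output
      ; out            = kept′
      }

    presents′ : Presents C′ S′
    presents′ = record
      { out-sound    = λ {v} r p → let q , ¬d = ∈-filter⁻ (λ x → ¬? (removed? v x)) {xs = out v} p
                                       r′ = reach′⇒reachable r in
                       r′ , out-sound (reachable⇒reach r′) q , ¬d
      ; out-complete = λ { {v} r (r′ , t , ¬d) → ∈-filter⁺ (λ x → ¬? (removed? v x))
                             (out-complete (reachable⇒reach r′) t) ¬d }
      ; output-𝟘     = λ r ¬t → let r′ = reach′⇒reachable r in
                       output-𝟘 (reachable⇒reach r′) λ t → ¬t (r′ , t)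
      }

    loops-· : ∀ {s v} →
      (∀ {l w} (d : Removed M v l w) → s w =Mil round (proj₁ d) w · s v) →
      loops v · s v =Mil ∑ (removed v) (s after_)
    loops-· {s} {v} h = transitivity (∑-· (removed v))
      (∑-cong (removed v) λ {x} p →
        entry-· (removed? v x) (proj₂ (∈-filter⁻ (removed? v) {xs = out v} p)))
      where
      entry-· : ∀ {l w} (d : Dec (Removed M v l w)) → Removed M v l w →
                entry d · s v =Mil ⟦ l ⟧ · s w
      entry-· (yes d) _ = transitivity ·-assoc (·-congˡ (symmetry (h d)))
      entry-· (no ¬d) d = ⊥-elim (¬d d)

    -- The removed entries contribute `loops v · s v` once their targets factor through `s v`. Both
    -- the restriction and the extension of solutions rest on this exchange.
    rhs-agrees : ∀ {s v} →
      (∀ {l w} (d : Removed M v l w) → s w =Mil round (proj₁ d) w · s v) →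
      prefix v · s v + remainder s v =Mil
      (prefix v + loops v) · s v + System.remainder S′ s v
    rhs-agrees {s} {v} h = begin
      prefix v · s v + (output v + ∑ (out v) (s after_))
        ≈⟨ +-congˡ (+-congˡ (∑-partition (removed? v) (out v))) ⟩
      prefix v · s v + (output v + (∑ (removed v) (s after_) + ∑ (kept′ v) (s after_)))
        ≈⟨ +-congˡ (+-congˡ (+-congʳ (symmetry (loops-· h)))) ⟩
      prefix v · s v + (output v + (loops v · s v + ∑ (kept′ v) (s after_)))
        ≈⟨ +-congˡ (transitivity (symmetry +-assoc) (transitivity (+-congʳ +-comm) +-assoc)) ⟩
      prefix v · s v + (loops v · s v + (output v + ∑ (kept′ v) (s after_)))
        ≈⟨ symmetry +-assoc ⟩
      (prefix v · s v + loops v · s v) + (output v + ∑ (kept′ v) (s after_))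
        ≈⟨ +-congʳ (symmetry ·-distrib-+) ⟩
      (prefix v + loops v) · s v + (output v + ∑ (kept′ v) (s after_)) ∎

    restrict : ∀ {s} → Solution C S s → Solution C′ S′ s
    restrict {s} sol {v} r = transitivity (sol rv) (rhs-agrees removed-target)
      where
      rv = reachable⇒reach (reach′⇒reachable r)

      -- Induction along the acyclic body: the solved equations for `s` and for `round i` agree up
      -- to the factor `s (head i)`.
      through-loop : ∀ i {w} → Acc (Loop._≺_ (L M i)) w → InLoop i w → Reach C w →
                     s w =Mil round i w · s (head i)
      through-loop i {w} (acc rs) p rw with em {w ≡ head i}
      ... | yes refl = transitivity (symmetry ·-identityˡ)
                         (·-congʳ (symmetry (round-head i)))
      ... | no w≢ = transitivity (solvesAt⇒solved (sol rw))
        (round-step i (b , rw) λ q → let t = out-sound rw q in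
          through-loop i (rs (b , _ , t)) (inLoop-step b t) (rw ◅◅ (_ , t) ◅ ε))
        where b = p , w≢

      removed-target : ∀ {l w} (d : Removed M v l w) →
                       s w =Mil round (proj₁ d) w · s v
      removed-target d@(i , refl , _) =
        through-loop i (Loop.≺-wellFounded (L M i) _) (removed⇒inLoop d)
          (rv ◅◅ (_ , removed⇒tr d) ◅ ε)

    module Extend (s′ : X → StExp A) (sol′ : Solution C′ S′ s′) where

      Through : X → Set
      Through w = ∃[ i ] Reachable M (head i) × InBody (L M i) w

      -- By `locate`, the default `𝟘` is never taken at a vertex reachable in `C`.
      extension-at : ∀ w → Dec (Reachable M w) → Dec (Through w) → StExp A
      extension-at w (yes _) _               = s′ w
      extension-at w (no _)  (yes (i , _)) = round i w · s′ (head i)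
      extension-at w (no _)  (no _)          = 𝟘

      extension : X → StExp A
      extension w = extension-at w em em

      extension-kept : ∀ {w} → Reachable M w → extension w =Mil s′ w
      extension-kept {w} r = go em
        where
        go : (d : Dec (Reachable M w)) → extension-at w d em =Mil s′ w
        go (yes _) = reflexivity
        go (no ¬r) = ⊥-elim (¬r r)

      kept-solves : ∀ {v} → Reachable M v →
        extension v =Mil (prefix v + loops v) · extension v
                         + System.remainder S′ extension v
      kept-solves {v} r = begin
        extension v ≈⟨ extension-kept r ⟩
        s′ v ≈⟨ sol′ (reachable⇒reach′ r) ⟩
        (prefix v + loops v) · s′ v + System.remainder S′ s′ v
          ≈⟨ +-cong (·-congˡ (symmetry (extension-kept r)))
               (System.remainder-cong S′ v λ p → symmetry (extension-kept (target-kept p))) ⟩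
        (prefix v + loops v) · extension v + System.remainder S′ extension v ∎
        where
        target-kept : ∀ {l w} → (l , w) ∈ₗ kept′ v → Reachable M w
        target-kept p = target C′ (Presents.out-sound presents′ (reachable⇒reach′ r) p)

      -- Every loop whose body contains w determines the same value at w.
      extension-round : ∀ i {w} → Acc (Loop._≺_ (L M i)) w → InLoop i w → Reach C w →
        ∀ j → Reachable M (head j) → InLoop j w →
        extension w =Mil round j w · extension (head j)
      extension-round i {w} (acc rs) p rw j rj q with em {w ≡ head j}
      ... | yes refl = transitivity (symmetry ·-identityˡ)
                         (·-congʳ (symmetry (round-head j)))
      ... | no w≢j = transitivity (unfolded em em) (round-body-j j rj bj)
        where
        bj = q , w≢j
        -- The induction descends in loop `i`, while the claim concerns loop `j`; as a body vertex
        -- of `j`, `w` is not the head of `i`.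
        bi : InBody (L M i) w
        bi = p , λ { refl → head-not-in-body i j bj }

        round-body-j : ∀ k → Reachable M (head k) → InBody (L M k) w →
          solved extension w =Mil round k w · extension (head k)
        round-body-j k rk bk = round-step k (bk , rw) λ x →
          let t = out-sound rw x in
          extension-round i (rs (bi , _ , t)) (inLoop-step bi t)
            (rw ◅◅ (_ , t) ◅ ε) k rk (inLoop-step bk t)

        unfolded : (d : Dec (Reachable M w)) (e : Dec (Through w)) →
                   extension-at w d e =Mil solved extension w
        -- No transition from a body vertex is removed, so the old and the new equation at `w`
        -- agree.
        unfolded (yes r) _ =
          transitivity (symmetry (extension-kept r))
            (solvesAt⇒solved (transitivity (kept-solves r)
              (symmetry (rhs-agrees λ d → ⊥-elim (body-not-removed bj d)))))
        unfolded (no ¬r) (yes (k , rk , bk)) =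
          transitivity (·-congˡ (symmetry (extension-kept rk)))
            (symmetry (round-body-j k rk bk))
        unfolded (no ¬r) (no ¬t) = ⊥-elim (¬t (j , rj , bj))

      in-loop : ∀ i {w} → Reachable M (head i) → Reach C w → InLoop i w →
                extension w =Mil round i w · extension (head i)
      in-loop i ri rw p =
        extension-round i (Loop.≺-wellFounded (L M i) _) p rw i ri p

      extension-solves : Solution C S extension
      extension-solves {v} rv with locate rv
      ... | kept r = transitivity (kept-solves r) (symmetry (rhs-agrees
              λ { d@(i , refl , _) → in-loop i r (rv ◅◅ (_ , removed⇒tr d) ◅ ε)
                                       (removed⇒inLoop d) }))
      ... | inBody i ri b = solved⇒solvesAt (transitivity (in-loop i ri rv (proj₁ b))
              (symmetry (round-step i (b , rv) λ p → let t = out-sound rv p in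
                in-loop i ri (rv ◅◅ (_ , t) ◅ ε) (inLoop-step b t))))

    -- Entries are proper, so all 1-transitions from kept vertices survive; inside a loop body,
    -- descent ends or arrives at the head, which is kept.
    one-steps-acc :
      (∀ {w} → Reach C′ w → Acc (λ u v → Tr C′ v one u) w) →
      ∀ {w} → Reach C w → Acc (λ u v → Tr C v one u) w
    one-steps-acc acc′ rw = located-acc (locate rw)
      where
      one-kept : ∀ {v w} → ¬ Removed M v one w
      one-kept d with entries-proper d
      ... | _ , ()

      kept-acc : ∀ {w} → Reachable M w → Acc (λ u v → Tr C′ v one u) w →
                 Acc (λ u v → Tr C v one u) w
      kept-acc r (acc rs) = acc λ t →
        let k = r , t , one-kept in kept-acc (target C′ k) (rs k)

      loop-acc : ∀ i {w} → Reachable M (head i) → Acc (Loop._≺_ (L M i)) w →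
                 InLoop i w → Acc (λ u v → Tr C v one u) w
      loop-acc i {w} ri (acc rs) p with em {w ≡ head i}
      ... | yes refl = kept-acc ri (acc′ (reachable⇒reach′ ri))
      ... | no w≢    = acc λ t →
              loop-acc i ri (rs ((p , w≢) , _ , t)) (inLoop-step (p , w≢) t)

      located-acc : ∀ {w} → Located w → Acc (λ u v → Tr C v one u) w
      located-acc (kept r)        = kept-acc r (acc′ (reachable⇒reach′ r))
      located-acc (inBody i ri b) =
        loop-acc i ri (Loop.≺-wellFounded (L M i) _) (proj₁ b)

  -- Solutions along a run

  step-wellFounded : ∀ {A X} {C : 1-Chart A X} → ¬ HasInfinitePath C →
                     WellFounded (λ u w → Step C w u)
  step-wellFounded ¬π w with em {Acc _ w}
  ... | yes a = a
  ... | no ¬a = let (π , π0 , steps) = descending-sequence ¬a in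
                ⊥-elim (¬π (w , π , π0 , steps))

  ProperRemovals : ∀ {A X} {C D : 1-Chart A X} → Run C D → Set
  ProperRemovals R = ∀ {n v l w} → RemovedIn R n v l w → ∃[ a ] l ≡ proper a

  module _ {A X : Set} {D : 1-Chart A X} (D-finite : ¬ HasInfinitePath D) where

    -- Both solutions are restricted step by step to the end of the run, with the start vertex
    -- unchanged. There `solved` determines values by induction along transitions.
    unique-solution : ∀ {C} (R : Run C D) → ProperRemovals R →
      ∀ {S} → Presents C S → ∀ {s t} → Solution C S s → Solution C S t →
      s (start C) =Mil t (start C)
    unique-solution [] _ {S} presents {s} {t} sol-s sol-t =
      agree ε (step-wellFounded {C = D} D-finite _)
      where
      open System S
      agree : ∀ {w} → Reach D w → Acc (λ u v → Step D v u) w → s w =Mil t w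
      agree {w} r (acc rs) =
        transitivity (solvesAt⇒solved (sol-s r))
          (transitivity
            (solved-cong w λ p →
              let t = Presents.out-sound presents r p in
              agree (r ◅◅ (_ , t) ◅ ε) (rs (_ , t)))
            (symmetry (solvesAt⇒solved (sol-t r))))
    unique-solution (M ∷ R) g {S} presents sol-s sol-t =
      unique-solution R (λ {n} → g {suc n}) presents′ (restrict sol-s) (restrict sol-t)
      where open Elimination M (g {zero}) S presents

    -- The acyclic system at the end of the run is solved first, and the solution is then extended
    -- backwards through the multi-steps.
    solution-exists : ∀ {C} (R : Run C D) → ProperRemovals R →
      ∀ {S} → Presents C S → Σ[ s ∈ (X → StExp A) ] Solution C S s
    solution-exists [] _ {S} presents =
      proj₁ solution , λ r → System.solved⇒solvesAt S (proj₁ (proj₂ solution) r)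
      where
      solution = solve-acyclic S (Reach D) (Subrelation.wellFounded
        (λ { (r , l , p) → l , Presents.out-sound presents r p })
        (step-wellFounded {C = D} D-finite))
    solution-exists (M ∷ R) g {S} presents =
      extension , extension-solves
      where
      open Elimination M (g {zero}) S presents
      solution′ = solution-exists R (λ {n} → g {suc n}) presents′
      open Extend (proj₁ solution′) (proj₂ solution′)

    one-steps-wellFounded : ∀ {C} (R : Run C D) → ProperRemovals R →
      ∀ {S} → Presents C S → ∀ {w} → Reach C w → Acc (λ u v → Tr C v one u) w
    one-steps-wellFounded [] _ presents r =
      Subrelation.wellFounded (λ t → one , t) (step-wellFounded {C = D} D-finite) _
    one-steps-wellFounded (M ∷ R) g {S} presents =
      one-steps-acc (one-steps-wellFounded R (λ {n} → g {suc n}) presents′)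
      where open Elimination M (g {zero}) S presents

  -- The witness and its guardedness speak about transitions of the initial 1-chart, so removals in
  -- later steps are traced back to it.
  removed⇒transition : ∀ {A X} {C D : 1-Chart A X} (R : Run C D) →
                       ∀ {n v l w} → RemovedIn R n v l w → Tr C v l w
  removed⇒transition (M ∷ R) {zero}  (i , refl , u) = U⊆ (L M i) u
  removed⇒transition (M ∷ R) {suc n} d =
    proj₁ (proj₂ (removed⇒transition R {n} d))

  guarded⇒properRemovals : ∀ {A X} {C : 1-Chart A X} (G : GuardedLLEE C) →
                           ProperRemovals (LLEE-Witness.run (proj₁ G))
  guarded⇒properRemovals (W , guarded) {n} d =
    guarded t λ label≡0 → 0≢1+n (trans (sym label≡0) (Equivalence.from (records t n) d))
    where
    open LLEE-Witness W
    t = removed⇒transition run {n} d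

  -- Functional 1-bisimulations

  -- A chart may have transitions for infinitely many actions; those from v are
  -- assumed to be bounded by the transitions of some star expression.
  module ChartSystem {A X : Set} (C : 1-Chart A X)
    (bound : ∀ {v} → Reach C v →
             Σ[ e ∈ StExp A ] (∀ {a w} → Tr C v (proper a) w → ∃[ f ] e —[ a ]→ f))
    where

    private
      labels : ∀ {v} → Dec (Reach C v) → List (Label A)
      labels (yes r) = one ∷ map proper (actions (proj₁ (bound r)))
      labels (no _)  = []

      ∈-labels : ∀ {v l w} (d : Dec (Reach C v)) → Reach C v → Tr C v l w → l ∈ₗ labels d
      ∈-labels {l = one}      (yes r) _ t = here refl
      ∈-labels {l = proper a} (yes r) _ t =
        there (∈-map⁺ proper (∈-actions (proj₂ (proj₂ (bound r) t))))
      ∈-labels (no ¬r) r t = ⊥-elim (¬r r)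

      tr? : ∀ v (x : Label A × X) → Dec (Tr C v (proj₁ x) (proj₂ x))
      tr? v x = em

      candidates : X → List (Label A × X)
      candidates v = cartesianProduct (labels (em {Reach C v})) (proj₁ (finite C))

    system : System A X
    system = record
      { prefix         = λ _ → 𝟘
      ; prefix-guarded = λ _ ()
      ; output         = λ v → does (em {Term C v}) ▸ 𝟙
      ; out            = λ v → filter (tr? v) (candidates v)
      }

    open System system

    presents : Presents C system
    presents = record
      { out-sound    = λ {v} _ p → proj₂ (∈-filter⁻ (tr? v) {xs = candidates v} p)
      ; out-complete = λ {v} r t → ∈-filter⁺ (tr? v)
          (∈-cartesianProduct⁺ (∈-labels em r t) (proj₂ (finite C) (target C t))) t
      ; output-𝟘     = λ _ → output-𝟘
      }
      where
      output-𝟘 : ∀ {v} → ¬ Term C v → does (em {Term C v}) ▸ 𝟙 ≡ 𝟘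
      output-𝟘 {v} ¬t with em {Term C v}
      ... | yes t = ⊥-elim (¬t t)
      ... | no _  = refl

    open Presents presents

    module _ {s : X → StExp A} {v : X} where

      solves-at⁺ : s v =Mil remainder s v → SolvesAt s v
      solves-at⁺ p = transitivity p (symmetry (transitivity (+-congʳ ·-zeroˡ) +-identityˡ))

      solves-at⁻ : SolvesAt s v → s v =Mil remainder s v
      solves-at⁻ p = transitivity p (transitivity (+-congʳ ·-zeroˡ) +-identityˡ)

      remainder-upper-term : Term C v → 𝟙 ⊑ remainder s v
      remainder-upper-term t with em {Term C v}
      ... | yes _ = +-upperˡ
      ... | no ¬t = ⊥-elim (¬t t)

      remainder-upper-tr : Reach C v → ∀ {l w} → Tr C v l w → ⟦ l ⟧ · s w ⊑ remainder s v
      remainder-upper-tr r t =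
        ⊑-trans (∑-upper {F = s after_} (out-complete r t)) +-upperʳ

      remainder-least : Reach C v → ∀ {h} → (Term C v → 𝟙 ⊑ h) →
        (∀ {l w} → Tr C v l w → ⟦ l ⟧ · s w ⊑ h) → remainder s v ⊑ h
      remainder-least r {h} p q =
        +-least output-least (∑-least (out v) λ x → q (out-sound r x))
        where
        output-least : output v ⊑ h
        output-least with em {Term C v}
        ... | yes t = p t
        ... | no _  = 𝟘-least

    module InducedBounds {s : X → StExp A} (sol : Solution C system s) where

      term⊑ : ∀ {v} → Reach C v → Term C v → 𝟙 ⊑ s v
      term⊑ r t = ⊑-trans (remainder-upper-term {s} t)
                          (⊑-reflexive (symmetry (solves-at⁻ (sol r))))

      tr⊑ : ∀ {v l w} → Reach C v → Tr C v l w → ⟦ l ⟧ · s w ⊑ s v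
      tr⊑ r t = ⊑-trans (remainder-upper-tr r t)
                        (⊑-reflexive (symmetry (solves-at⁻ (sol r))))

      one⊑ : ∀ {v w} → Reach C v → Tr C v one w → s w ⊑ s v
      one⊑ r t = ⊑-trans (⊑-reflexive (symmetry ·-identityˡ)) (tr⊑ r t)

      induced-term⊑ : ∀ {v} → Reach C v → InducedTerm C v → 𝟙 ⊑ s v
      induced-term⊑ r (_ , ε , t)      = term⊑ r t
      induced-term⊑ r (x , t ◅ ts , p) =
        ⊑-trans (induced-term⊑ (reach-step C r t) (x , ts , p)) (one⊑ r t)

      induced-tr⊑ : ∀ {v a w} → Reach C v → InducedTr C v a w → act a · s w ⊑ s v
      induced-tr⊑ r (_ , ε , t)      = tr⊑ r t
      induced-tr⊑ r (x , t ◅ ts , p) =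
        ⊑-trans (induced-tr⊑ (reach-step C r t) (x , ts , p)) (one⊑ r t)

      -- Induction on 1-transitions replaces each 1-summand by the behaviour of its target. So a
      -- solution is the least upper bound of its induced behaviour.
      induced-least : ∀ {v h} → Acc (λ u v → Tr C v one u) v → Reach C v →
        (InducedTerm C v → 𝟙 ⊑ h) →
        (∀ {a w} → InducedTr C v a w → act a · s w ⊑ h) → s v ⊑ h
      induced-least {v} {h} (acc rs) r p q =
        ⊑-trans (⊑-reflexive (solves-at⁻ (sol r)))
          (remainder-least r (λ t → p (_ , ε , t)) by-label)
        where
        by-label : ∀ {l w} → Tr C v l w → ⟦ l ⟧ · s w ⊑ h
        by-label {proper a} t = q (_ , ε , t)
        by-label {one}      t = ⊑-trans (⊑-reflexive ·-identityˡ)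
          (induced-least (rs t) (reach-step C r t)
            (λ i → p (one-then-induced-term C t i))
            (λ i → q (one-then-induced-tr C t i)))

  module FunctionalBisimulation {A X Y : Set} {C : 1-Chart A X} {D : 1-Chart A Y}
    (B : Functional1-Bisimulation C D) where

    open Is1-Bisimulation (proj₁ (proj₂ B)) public
    private
      graph = proj₂ (proj₂ B)

    _∼_ : X → Y → Set
    _∼_ = proj₁ B

    functional : ∀ {v w w′} → v ∼ w → v ∼ w′ → w ≡ w′
    functional = proj₂ graph

    -- The value 𝟘 outside of the vertices of C is irrelevant.
    along : (Y → StExp A) → X → StExp A
    along s v = go em
      where
      go : Dec (v ∈ V C) → StExp A
      go (yes p) = s (proj₁ (proj₁ graph p))
      go (no _)  = 𝟘

    image : ∀ {v} → v ∈ V C → ∃[ w ] v ∼ w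
    image = proj₁ graph

    along-∼ : ∀ s {v w} → v ∼ w → along s v ≡ s w
    along-∼ s {v} b with em {v ∈ V C}
    ... | yes p = cong s (functional (proj₂ (proj₁ graph p)) b)
    ... | no ¬p = ⊥-elim (¬p (proj₁ (vertices b)))

  -- Joint expansions

  module Expansion {A X : Set} {C : 1-Chart A X} {e : StExp A}
    (B : Functional1-Bisimulation C (𝒞 e)) where

    open FunctionalBisimulation {C = C} {D = 𝒞 e} B

    bound : ∀ {v} → Reach C v →
            Σ[ f ∈ StExp A ] (∀ {a w} → Tr C v (proper a) w → ∃[ g ] f —[ a ]→ g)
    bound r = let (f , b) = image (reach∈ C (start∈ C) r) in
      f , λ t → let (g , p , _) = forth b (_ , ε , t) in g , 𝒞-induced-tr p

    σ : X → StExp A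
    σ = along λ f → f

    σ-start : σ (start C) ≡ e
    σ-start = along-∼ _ starts

    -- The bound is arbitrary, so that the functions to both chart interpretations solve one and the
    -- same system.
    module _ {bound′ : ∀ {v} → Reach C v →
      Σ[ f ∈ StExp A ] (∀ {a w} → Tr C v (proper a) w → ∃[ g ] f —[ a ]→ g)} where

      open ChartSystem C bound′
      open System system

      -- A transition of `g` is matched from `w`, is induced at `v` through the 1-transition, and is
      -- matched back from `f`. Functionality identifies the two targets.
      one⊑ : ∀ {v w f g} → v ∼ f → w ∼ g → Tr C v one w → g ⊑ f
      one⊑ b b′ t = ⊑-by-transitions
        (λ d → 𝟙⊑ (𝒞-induced-term (Equivalence.to (termination b)
          (one-then-induced-term C t (Equivalence.from (termination b′)
            (_ , ε , proj₂ (vertices b′) , d))))))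
        (λ p → let (w′ , i , c)  = back b′ (_ , ε , step (proj₂ (vertices b′)) p)
                   (g′ , j , c′) = forth b (one-then-induced-tr C t i) in
          act·⊑ (subst (_ —[ _ ]→_) (functional c′ c) (𝒞-induced-tr j)))

      tr⊑ : ∀ {v l w f g} → v ∼ f → w ∼ g → Tr C v l w → ⟦ l ⟧ · g ⊑ f
      tr⊑ {l = one}      b b′ t = ⊑-trans (⊑-reflexive ·-identityˡ) (one⊑ b b′ t)
      tr⊑ {l = proper a} b b′ t =
        let (g′ , j , c) = forth b (_ , ε , t) in
        act·⊑ (subst (_ —[ _ ]→_) (functional c b′) (𝒞-induced-tr j))

      -- The summands lie below the image of `v` by `tr⊑`. Conversely, each transition of the image
      -- is matched by an induced one from `v`, whose first step is a summand above it.
      σ-solves : Solution C system σ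
      σ-solves {v} r = solves-at⁺ (⊑-antisym σ⊑ (remainder-least r
        (λ t → σ⊒ (𝟙⊑ (𝒞-induced-term (Equivalence.to (termination b) (_ , ε , t)))))
        λ {l} {w} t →
          let (g , b′) = image (target C t) in
          subst (λ x → ⟦ l ⟧ · x ⊑ σ v) (sym (along-∼ _ b′)) (σ⊒ (tr⊑ b b′ t))))
        where
        f = proj₁ (image (reach∈ C (start∈ C) r))
        b = proj₂ (image (reach∈ C (start∈ C) r))

        σ⊒ : ∀ {x} → x ⊑ f → x ⊑ σ v
        σ⊒ = subst (_ ⊑_) (sym (along-∼ _ b))

        one⊑remainder : ∀ {w} → Tr C v one w → ∀ {g x} → w ∼ g → x ⊑ g → x ⊑ remainder σ v
        one⊑remainder t b′ p = ⊑-trans (subst (_ ⊑_) (sym (along-∼ _ b′)) p)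
          (⊑-trans (⊑-reflexive (symmetry ·-identityˡ)) (remainder-upper-tr r t))

        term⊑remainder : InducedTerm C v → 𝟙 ⊑ remainder σ v
        term⊑remainder (_ , ε , t)      = remainder-upper-term {σ} t
        term⊑remainder (x , t ◅ ts , p) =
          let (g , b′) = image (target C t) in
          one⊑remainder t b′ (𝟙⊑ (𝒞-induced-term
            (Equivalence.to (termination b′) (x , ts , p))))

        tr⊑remainder : ∀ {a w g} → w ∼ g → InducedTr C v a w → act a · g ⊑ remainder σ v
        tr⊑remainder {a} c (_ , ε , t) =
          subst (λ x → act a · x ⊑ remainder σ v) (along-∼ _ c) (remainder-upper-tr r t)
        tr⊑remainder c (x , t ◅ ts , p) =
          let (g , b′) = image (target C t)
              (g′ , j , c′) = forth b′ (x , ts , p) in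
          one⊑remainder t b′ (act·⊑ (subst (_ —[ _ ]→_) (functional c′ c) (𝒞-induced-tr j)))

        σ⊑ : σ v ⊑ remainder σ v
        σ⊑ = subst (_⊑ remainder σ v) (sym (along-∼ _ b)) (⊑-by-transitions
          (λ d → term⊑remainder (Equivalence.from (termination b)
            (_ , ε , proj₂ (vertices b) , d)))
          (λ p → let (w , i , c) = back b (_ , ε , step (proj₂ (vertices b)) p) in
            tr⊑remainder c i))

  -- Joint minimizations

  module Minimization {A X : Set} {C : 1-Chart A X} {e : StExp A}
    (B : Functional1-Bisimulation (𝒞 e) C) where

    open FunctionalBisimulation {C = 𝒞 e} {D = C} B

    -- A target of a 1-transition may lie outside the image of the function, hence the 1-path from a
    -- vertex in the image. It bounds the actions possible at `v`.
    related : ∀ {v} → Reach C v →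
              ∃[ f ] ∃[ u ] f ∼ u × Star (λ x y → Tr C x one y) u v
    related = go (e , start C , starts , ε)
      where
      go : ∀ {u v} → (∃[ f ] ∃[ x ] f ∼ x × Star (λ x y → Tr C x one y) x u) →
           Star (Step C) u v → ∃[ f ] ∃[ x ] f ∼ x × Star (λ x y → Tr C x one y) x v
      go p ε = p
      go (f , x , b , ts) ((one , t) ◅ ss) = go (f , x , b , ts ◅◅ t ◅ ε) ss
      go (f , x , b , ts) ((proper a , t) ◅ ss) =
        let (g , _ , b′) = back b (_ , ts , t) in go (g , _ , b′ , ε) ss

    bound : ∀ {v} → Reach C v →
            Σ[ f ∈ StExp A ] (∀ {a w} → Tr C v (proper a) w → ∃[ g ] f —[ a ]→ g)
    bound r = let (f , u , b , ts) = related r in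
      f , λ t → let (g , p , _) = back b (_ , ts , t) in g , 𝒞-induced-tr p

    reach-image : ∀ {f} → Star _⟶_ e f → ∃[ v ] f ∼ v × Reach C v
    reach-image = go starts ε
      where
      go : ∀ {f g v} → f ∼ v → Reach C v → Star _⟶_ f g → ∃[ w ] g ∼ w × Reach C w
      go b r ε = _ , b , r
      go b r ((_ , p) ◅ ps) =
        let (w , i , b′) = forth b (_ , ε , step (proj₁ (vertices b)) p) in
        go b′ (reach-induced C r i) ps

    module _ {bound′ : ∀ {v} → Reach C v →
      Σ[ f ∈ StExp A ] (∀ {a w} → Tr C v (proper a) w → ∃[ g ] f —[ a ]→ g)}
      (one-acc : ∀ {v} → Reach C v → Acc (λ u v → Tr C v one u) v)
      {s : X → StExp A} (sol : Solution C (ChartSystem.system C bound′) s) where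

      open ChartSystem.InducedBounds C bound′ sol

      ρ : StExp A → StExp A
      ρ = along s

      -- Both sides are least upper bounds, of the induced behaviour of the image and of the
      -- behaviour of `f`; the bisimulation conditions match these.
      ρ-expansion : ∀ {f} → Star _⟶_ e f → ρ f =Mil expansion ρ f
      ρ-expansion {f} p = transitivity (≡⇒=Mil (along-∼ s b)) (⊑-antisym
        (induced-least (one-acc r) r
          (λ t → expansion-upper-↓ (𝒞-induced-term (Equivalence.from (termination b) t)))
          λ {a} i → let (g , j , c) = back b i in
            subst (λ x → act a · x ⊑ expansion ρ f) (along-∼ s c)
              (expansion-upper-→ (𝒞-induced-tr j)))
        (expansion-least
          (λ d → induced-term⊑ r (Equivalence.to (termination b) (_ , ε , p , d)))
          λ {a} q → let (w , i , c) = forth b (_ , ε , step p q) in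
            subst (λ x → act a · x ⊑ s v) (sym (along-∼ s c)) (induced-tr⊑ r i)))
        where
        v = proj₁ (reach-image p)
        b = proj₁ (proj₂ (reach-image p))
        r = proj₂ (proj₂ (reach-image p))

      -- Unique solvability of `𝒞 e`, applied to `ρ` with continuation `𝟙`.
      solution-at-start : e =Mil s (start C)
      solution-at-start =
        transitivity (symmetry ·-identityʳ)
        (transitivity (symmetry (solution-of-expression e (Star _⟶_ e)
          (λ p q → p ◅◅ (_ , q) ◅ ε) ρ-expansion (λ q → (_ , q) ◅ ε)))
        (transitivity (symmetry (ρ-expansion ε)) (≡⇒=Mil (along-∼ s starts))))

corollary6p14 : ExcludedMiddle 0ℓ →
    (A : Set) →
    ((e₁ e₂ : StExp A) →
    Σ[ X ∈ Set ] Σ[ C ∈ 1-Chart A X ]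
    (GuardedLLEE C
    × Functional1-Bisimulation C (𝒞 e₁)
    × Functional1-Bisimulation C (𝒞 e₂)) →
    e₁ =Mil e₂)
    ×
    ((e₁ e₂ : StExp A) →
    Σ[ X ∈ Set ] Σ[ C ∈ 1-Chart A X ]
    (GuardedLLEE C
    × Functional1-Bisimulation (𝒞 e₁) C
    × Functional1-Bisimulation (𝒞 e₂) C) →
    e₁ =Mil e₂)
corollary6p14 em A = expansion-case , minimization-case
  where
  open Classical em

  expansion-case : (e₁ e₂ : StExp A) →
    Σ[ X ∈ Set ] Σ[ C ∈ 1-Chart A X ]
    (GuardedLLEE C
    × Functional1-Bisimulation C (𝒞 e₁)
    × Functional1-Bisimulation C (𝒞 e₂)) →
    e₁ =Mil e₂
  expansion-case e₁ e₂ (X , C , G , B₁ , B₂) =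
    transitivity (≡⇒=Mil (sym E₁.σ-start))
      (transitivity
        (unique-solution successful run (λ {n} → guarded⇒properRemovals G {n})
          presents E₁.σ-solves E₂.σ-solves)
        (≡⇒=Mil E₂.σ-start))
    where
    open LLEE-Witness (proj₁ G)
    module E₁ = Expansion B₁
    module E₂ = Expansion B₂
    open ChartSystem C E₁.bound

  minimization-case : (e₁ e₂ : StExp A) →
    Σ[ X ∈ Set ] Σ[ C ∈ 1-Chart A X ]
    (GuardedLLEE C
    × Functional1-Bisimulation (𝒞 e₁) C
    × Functional1-Bisimulation (𝒞 e₂) C) →
    e₁ =Mil e₂
  minimization-case e₁ e₂ (X , C , G , B₁ , B₂) =
    transitivity (M₁.solution-at-start one-acc sol) (symmetry (M₂.solution-at-start one-acc sol))
    where
    open LLEE-Witness (proj₁ G)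
    module M₁ = Minimization {C = C} B₁
    module M₂ = Minimization {C = C} B₂
    open ChartSystem C M₁.bound
    proper-removals : ProperRemovals run
    proper-removals {n} = guarded⇒properRemovals G {n}
    -- One solution of `C` serves both expressions: each equals its value at the start vertex.
    sol = proj₂ (solution-exists successful run (λ {n} → proper-removals {n}) presents)
    one-acc = one-steps-wellFounded successful run (λ {n} → proper-removals {n}) presents
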